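{- Let $\theta$ be a real number whose simple continued fraction has the form $$\theta=[c_0;c_1,\ldots,c_{n_1},a_0,c_{n_1+1},\ldots,c_{n_1+n_2},a_1,c_{n_1+n_2+1},\ldots],$$ where $\lim_{i\to\infty}a_i=\infty$, every $n_j\ge 0$, and $\{c_i\}$ is a bounded sequence. Let $\phi=(r\theta+m)/n$, where $r,m,n$ are integers with $n\ge 2$, $\gcd(r,m,n)=1$ and $0\le r,m<n$. Then $L(\theta,\phi)=0$ if and only if there exist infinitely many leapers $\mathcal{L}_j$ of $\theta$ such that $g_j\,\mathcal{L}_j\equiv (m,-r)\pmod n$ for some integer $g_j$ that is invertible modulo $n$.
   Context: For real numbers $\theta,\phi$ with $\phi\notin\mathbb{Z}\theta+\mathbb{Z}$, the inhomogeneous approximation constant is $L(\theta,\phi)=\liminf_{|q|\to\infty}\{|q|\,\|q\theta-\phi\| : q\in\mathbb{Z}\}$, where $\|x\|$ is the distance from $x$ to the nearest integer. Write $\theta=[b_0;b_1,b_2,\ldots]$ for the simple continued fraction. For $i\ge0$ the $i$-th convergent is the pair $\mathcal{P}_i=(p_i,q_i)$ with $q_i>0$, $\gcd(p_i,q_i)=1$ and $p_i/q_i=[b_0;b_1,\ldots,b_i]$. In the given continued fraction the partial quotients are split into the terms $c_i$ and the terms $a_j$. A subscript $I_j\ge 0$ is called a leaping subscript if $b_{I_j+1}$ is the term $a_j$; the associated leaper is $\mathcal{L}_j=\mathcal{P}_{I_j}=(p_{I_j},q_{I_j})$. Congruences between integer pairs are componentwise. -}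

module Defs where

open import Data.Nat as ℕ using (ℕ; zero; suc)
import Data.Nat.Properties as ℕₚ
open import Data.Integer as ℤ using (ℤ; +_)
import Data.Integer.Properties as ℤₚ
open import Data.Integer.Divisibility using (_∣_)
import Data.Integer.DivMod as ℤ-DivMod
open import Data.Rational as ℚ
open import Data.Rational.Literals using (fromℤ)
open import Data.Rational.Properties
open import Data.Rational.Solver using (module +-*-Solver)
open import Data.Product using (Σ; ∃; _×_; _,_; proj₁; proj₂)
open import Data.Sum using (_⊎_; inj₁; inj₂; [_,_]′)
open import Relation.Binary.PropositionalEquality

‖_‖ℚ : ℚ → ℚ
‖ p ‖ℚ = (p - fromℤ (floor p)) ⊓ (fromℤ (ceiling p) - p)

floor≤ : ∀ p → fromℤ (floor p) ≤ p
floor≤ p@record{} = *≤* (subst ((floor p ℤ.* ↧ p) ℤ.≤_) (sym (ℤₚ.*-identityʳ (↥ p)))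
  (ℤ-DivMod.[n/d]*d≤n (↥ p) (↧ p)))

floor-greatest : ∀ k p → fromℤ k ≤ p → k ℤ.≤ floor p
floor-greatest k p@record{} (*≤* k≤p) =
  subst₂ ℤ._≤_ (ℤₚ.pred-suc k) (ℤₚ.pred-suc (floor p)) (ℤₚ.pred-mono (ℤₚ.i<j⇒suc[i]≤j k<))
  where
  k<suc : k ℤ.< ℤ.suc (↥ p ℤ./ℕ ↧ₙ p)
  k<suc = ℤₚ.*-cancelʳ-<-nonNeg (↧ p) (ℤₚ.≤-<-trans
    (subst (k ℤ.* ↧ p ℤ.≤_) (ℤₚ.*-identityʳ (↥ p)) k≤p)
    (ℤ-DivMod.n<s[n/ℕd]*d (↥ p) (↧ₙ p)))
  k< : k ℤ.< ℤ.suc (floor p)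
  k< = subst (λ z → k ℤ.< ℤ.suc z) (sym (ℤ-DivMod.div-pos-is-/ℕ (↥ p) (↧ₙ p))) k<suc

fromℤ-mono : ∀ {i j} → i ℤ.≤ j → fromℤ i ≤ fromℤ j
fromℤ-mono {i} {j} i≤j =
  *≤* (subst₂ ℤ._≤_ (sym (ℤₚ.*-identityʳ i)) (sym (ℤₚ.*-identityʳ j)) i≤j)

fromℤ-neg : ∀ i → fromℤ (ℤ.- i) ≡ - fromℤ i
fromℤ-neg (+ zero) = refl
fromℤ-neg (ℤ.+[1+ _ ]) = refl
fromℤ-neg (ℤ.-[1+ _ ]) = refl

neg-involutive : ∀ p → - - p ≡ p
neg-involutive = solve 1 (λ p → :- (:- p) := p) refl
  where open +-*-Solver

≤ceiling : ∀ p → p ≤ fromℤ (ceiling p)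
≤ceiling p@record{} = subst₂ _≤_ (neg-involutive p) (sym (fromℤ-neg (floor (- p))))
  (neg-antimono-≤ (floor≤ (- p)))

ceiling-least : ∀ k p → p ≤ fromℤ k → ceiling p ℤ.≤ k
ceiling-least k p@record{} p≤k = subst (ceiling p ℤ.≤_) (ℤₚ.neg-involutive k)
  (ℤₚ.neg-mono-≤ (floor-greatest (ℤ.- k) (- p)
    (subst (_≤ - p) (sym (fromℤ-neg k)) (neg-antimono-≤ p≤k))))

p≤q⇒0≤q-p : ∀ p q → p ≤ q → 0ℚ ≤ q - p
p≤q⇒0≤q-p p q p≤q = subst (_≤ q - p) (+-inverseʳ p) (+-monoˡ-≤ (- p) p≤q)

∣p-q∣≡∣q-p∣ : ∀ p q → ∣ p - q ∣ ≡ ∣ q - p ∣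
∣p-q∣≡∣q-p∣ p q = trans (sym (∣-p∣≡∣p∣ (p - q)))
  (cong ∣_∣ (solve 2 (λ p q → :- (p :- q) := q :- p) refl p q))
  where open +-*-Solver

‖p‖≤∣p-k∣ : ∀ p k → ‖ p ‖ℚ ≤ ∣ p - fromℤ k ∣
‖p‖≤∣p-k∣ p k with ≤-total (fromℤ k) p
... | inj₁ k≤p = ≤-trans (p⊓q≤p (p - fromℤ (floor p)) (fromℤ (ceiling p) - p)) (subst (p - fromℤ (floor p) ≤_)
        (sym (0≤p⇒∣p∣≡p (p≤q⇒0≤q-p (fromℤ k) p k≤p)))
        (+-monoʳ-≤ p (neg-antimono-≤ (fromℤ-mono {k} {floor p} (floor-greatest k p k≤p)))))
... | inj₂ p≤k = ≤-trans (p⊓q≤q (p - fromℤ (floor p)) (fromℤ (ceiling p) - p)) (subst (fromℤ (ceiling p) - p ≤_)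
        (sym (trans (∣p-q∣≡∣q-p∣ p (fromℤ k)) (0≤p⇒∣p∣≡p (p≤q⇒0≤q-p p (fromℤ k) p≤k))))
        (+-monoˡ-≤ (- p) (fromℤ-mono {ceiling p} {k} (ceiling-least k p p≤k))))

‖‖-attained : ∀ p → ∃ λ k → ‖ p ‖ℚ ≡ ∣ p - fromℤ k ∣
‖‖-attained p with ⊓-sel (p - fromℤ (floor p)) (fromℤ (ceiling p) - p)
... | inj₁ eq = floor p , trans eq (sym (0≤p⇒∣p∣≡p (p≤q⇒0≤q-p (fromℤ (floor p)) p (floor≤ p))))
... | inj₂ eq = ceiling p , trans eq (sym (trans (∣p-q∣≡∣q-p∣ p (fromℤ (ceiling p)))
        (0≤p⇒∣p∣≡p (p≤q⇒0≤q-p p (fromℤ (ceiling p)) (≤ceiling p)))))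

triangle : ∀ p q r → ∣ p - r ∣ ≤ ∣ p - q ∣ + ∣ q - r ∣
triangle p q r = subst (λ z → ∣ z ∣ ≤ ∣ p - q ∣ + ∣ q - r ∣)
  (solve 3 (λ p q r → (p :- q) :+ (q :- r) := p :- r) refl p q r)
  (∣p+q∣≤∣p∣+∣q∣ (p - q) (q - r))
  where open +-*-Solver

∣p-q∣≤ : ∀ p q r → p ≤ r + q → q ≤ r + p → ∣ p - q ∣ ≤ r
∣p-q∣≤ p q r p≤ q≤ = [ (λ eq → subst (_≤ r) (sym eq) (move p q p≤))
                           , (λ eq → subst (_≤ r) (sym (trans eq flip)) (move q p q≤)) ]′
                           (∣p∣≡p∨∣p∣≡-p (p - q))
  where
  open +-*-Solver
  flip : - (p - q) ≡ q - p
  flip = solve 2 (λ p q → :- (p :- q) := q :- p) refl p q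
  move : ∀ x y → x ≤ r + y → x - y ≤ r
  move x y x≤ = subst (x - y ≤_)
    (solve 2 (λ r y → (r :+ y) :- y := r) refl r y) (+-monoˡ-≤ (- y) x≤)

‖‖-lipschitz : ∀ p q → ∣ ‖ p ‖ℚ - ‖ q ‖ℚ ∣ ≤ 1ℚ * ∣ p - q ∣
‖‖-lipschitz p q = subst (∣ ‖ p ‖ℚ - ‖ q ‖ℚ ∣ ≤_) (sym (*-identityˡ ∣ p - q ∣))
  (∣p-q∣≤ ‖ p ‖ℚ ‖ q ‖ℚ ∣ p - q ∣ (half p q)
    (subst (λ z → ‖ q ‖ℚ ≤ z + ‖ p ‖ℚ) (∣p-q∣≡∣q-p∣ q p) (half q p)))
  where
  half : ∀ p q → ‖ p ‖ℚ ≤ ∣ p - q ∣ + ‖ q ‖ℚ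
  half p q with ‖‖-attained q
  ... | k , eq = subst (λ z → ‖ p ‖ℚ ≤ ∣ p - q ∣ + z) (sym eq)
    (≤-trans (‖p‖≤∣p-k∣ p k) (triangle p q (fromℤ k)))

-- Cauchy sequences of rationals; no equality on ℝ is imposed, every relation
-- on ℝ below being invariant under equality of limits.
record ℝ : Set where
  field
    approx   : ℕ → ℚ
    isCauchy : ∀ ε → 0ℚ < ε → ∃ λ N → ∀ m n → N ℕ.≤ m → N ℕ.≤ n →
               ∣ approx m - approx n ∣ < ε

open ℝ public

fromℚ : ℚ → ℝ
fromℚ p .approx _ = p
fromℚ p .isCauchy ε 0<ε = 0 , λ _ _ _ _ → subst (λ z → ∣ z ∣ < ε) (sym (+-inverseʳ p)) 0<ε

extend : (f : ℚ → ℚ) (K : ℚ) → Positive K →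
         (∀ p q → ∣ f p - f q ∣ ≤ K * ∣ p - q ∣) → ℝ → ℝ
extend f K K>0 lip x .approx n = f (approx x n)
extend f K K>0 lip x .isCauchy ε 0<ε = N , close
  where
  instance
    posK : Positive K
    posK = K>0
    nzK : NonZero K
    nzK = pos⇒nonZero K
    pos1/K : Positive (1/ K)
    pos1/K = 1/pos⇒pos K
  δ : ℚ
  δ = 1/ K * ε
  0<δ : 0ℚ < δ
  0<δ = subst (_< δ) (*-zeroʳ (1/ K)) (*-monoʳ-<-pos (1/ K) 0<ε)
  Kδ≡ε : K * δ ≡ ε
  Kδ≡ε = trans (sym (*-assoc K (1/ K) ε))
    (trans (cong (_* ε) (*-inverseʳ K)) (*-identityˡ ε))
  N : ℕ
  N = proj₁ (isCauchy x δ 0<δ)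
  close : ∀ m n → N ℕ.≤ m → N ℕ.≤ n → ∣ f (approx x m) - f (approx x n) ∣ < ε
  close m n N≤m N≤n = ≤-<-trans (lip _ _) (subst (K * ∣ approx x m - approx x n ∣ <_) Kδ≡ε
    (*-monoʳ-<-pos K (proj₂ (isCauchy x δ 0<δ) m n N≤m N≤n)))

infixl 6 _+ᴿ_ _-ᴿ_
infixl 7 _·_
infix  4 _<ᴿ_

_+ᴿ_ : ℝ → ℝ → ℝ
(x +ᴿ y) .approx n = approx x n + approx y n
(x +ᴿ y) .isCauchy ε 0<ε = Nx ℕ.⊔ Ny , close
  where
  η : ℚ
  η = ½ * ε
  0<η : 0ℚ < η
  0<η = subst (_< η) (*-zeroʳ ½) (*-monoʳ-<-pos ½ 0<ε)
  η+η≡ε : η + η ≡ ε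
  η+η≡ε = trans (sym (*-distribʳ-+ ε ½ ½)) (*-identityˡ ε)
  Nx Ny : ℕ
  Nx = proj₁ (isCauchy x η 0<η)
  Ny = proj₁ (isCauchy y η 0<η)
  close : ∀ m n → Nx ℕ.⊔ Ny ℕ.≤ m → Nx ℕ.⊔ Ny ℕ.≤ n →
          ∣ (approx x m + approx y m) - (approx x n + approx y n) ∣ < ε
  close m n N≤m N≤n = subst₂ _<_
    (cong ∣_∣ (solve 4 (λ a b c d → (a :- c) :+ (b :- d) := (a :+ b) :- (c :+ d)) refl
      (approx x m) (approx y m) (approx x n) (approx y n)))
    η+η≡ε
    (≤-<-trans (∣p+q∣≤∣p∣+∣q∣ (approx x m - approx x n) (approx y m - approx y n)) (+-mono-<
      (proj₂ (isCauchy x η 0<η) m n (ℕₚ.m⊔n≤o⇒m≤o Nx Ny N≤m) (ℕₚ.m⊔n≤o⇒m≤o Nx Ny N≤n))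
      (proj₂ (isCauchy y η 0<η) m n (ℕₚ.m⊔n≤o⇒n≤o Nx Ny N≤m) (ℕₚ.m⊔n≤o⇒n≤o Nx Ny N≤n))))
    where open +-*-Solver

_·_ : ℚ → ℝ → ℝ
c · x = extend (c *_) (1ℚ + ∣ c ∣) (pos+nonNeg⇒pos 1ℚ ∣ c ∣ {{∣-∣-nonNeg c}}) lip x
  where
  open +-*-Solver
  lip : ∀ p q → ∣ c * p - c * q ∣ ≤ (1ℚ + ∣ c ∣) * ∣ p - q ∣
  lip p q = ≤-trans
    (≤-reflexive (trans
      (cong ∣_∣ (solve 3 (λ c p q → c :* p :- c :* q := c :* (p :- q)) refl c p q))
      (∣p*q∣≡∣p∣*∣q∣ c (p - q))))
    (*-monoʳ-≤-nonNeg ∣ p - q ∣ {{∣-∣-nonNeg (p - q)}}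
      (subst (_≤ 1ℚ + ∣ c ∣) (+-identityˡ ∣ c ∣) (+-monoˡ-≤ ∣ c ∣ (<⇒≤ (positive⁻¹ 1ℚ)))))

_-ᴿ_ : ℝ → ℝ → ℝ
x -ᴿ y = x +ᴿ (- 1ℚ) · y

∣_∣ᴿ : ℝ → ℝ
∣_∣ᴿ = extend ∣_∣ 1ℚ _ λ p q → subst (∣ ∣ p ∣ - ∣ q ∣ ∣ ≤_) (sym (*-identityˡ ∣ p - q ∣))
  (∣p-q∣≤ (∣ p ∣) (∣ q ∣) (∣ p - q ∣) (half p q)
    (subst (λ z → ∣ q ∣ ≤ z + ∣ p ∣) (∣p-q∣≡∣q-p∣ q p) (half q p)))
  where
  open +-*-Solver
  half : ∀ p q → ∣ p ∣ ≤ ∣ p - q ∣ + ∣ q ∣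
  half p q = subst (λ z → ∣ z ∣ ≤ ∣ p - q ∣ + ∣ q ∣)
    (solve 2 (λ p q → (p :- q) :+ q := p) refl p q) (∣p+q∣≤∣p∣+∣q∣ (p - q) q)

-- Constructively the nearest integer to a real is not computable, but the
-- distance to it is, by continuity.
‖_‖ : ℝ → ℝ
‖_‖ = extend ‖_‖ℚ 1ℚ _ ‖‖-lipschitz

_<ᴿ_ : ℝ → ℝ → Set
x <ᴿ y = ∃ λ ε → 0ℚ < ε × ∃ λ N → ∀ n → N ℕ.≤ n → approx x n + ε ≤ approx y n

ConvergesTo : (ℕ → ℝ) → ℝ → Set
ConvergesTo s x = ∀ ε → 0ℚ < ε → ∃ λ N → ∀ i → N ℕ.≤ i → ∣ s i -ᴿ x ∣ᴿ <ᴿ fromℚ ε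

-- liminf of f q as ∣ q ∣ → ∞ equals ℓ.  Over constructive reals a liminf
-- need not exist, so it is a relation.
IsLiminf : (ℤ → ℝ) → ℝ → Set
IsLiminf f ℓ =
  (∀ ε → 0ℚ < ε → ∃ λ N → ∀ q → N ℕ.≤ ℤ.∣ q ∣ → ℓ -ᴿ fromℚ ε <ᴿ f q) ×
  (∀ ε → 0ℚ < ε → ∀ N → ∃ λ q → N ℕ.≤ ℤ.∣ q ∣ × f q <ᴿ ℓ +ᴿ fromℚ ε)

-- L(θ,φ) = ℓ, where L(θ,φ) = liminf ∣q∣ ‖qθ − φ‖.
IsInhomogeneousConstant : ℝ → ℝ → ℝ → Set
IsInhomogeneousConstant θ φ =
  IsLiminf (λ q → fromℤ (+ ℤ.∣ q ∣) · ‖ fromℤ q · θ -ᴿ φ ‖)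

record SimpleCF : Set where
  field
    quotient : ℕ → ℤ
    quotient-positive : ∀ i → ℤ.Positive (quotient (suc i))

open SimpleCF public using (quotient)

shift : SimpleCF → SimpleCF
shift b .SimpleCF.quotient i = quotient b (suc i)
shift b .SimpleCF.quotient-positive i = SimpleCF.quotient-positive b (suc i)

-- value b i = [ b₀ ; b₁ , … , bᵢ ]
value : SimpleCF → ℕ → ℚ
value-shift-positive : ∀ b i → Positive (value (shift b) i)

value b zero    = fromℤ (quotient b 0)
value b (suc i) = fromℤ (quotient b 0) +
  (1/ value (shift b) i) {{pos⇒nonZero (value (shift b) i) {{value-shift-positive b i}}}}

fromℤ-positive : ∀ {i} → ℤ.Positive i → Positive (fromℤ i)
fromℤ-positive {ℤ.+[1+ _ ]} _ = _

value-shift-positive b zero    = fromℤ-positive {quotient b 1} (SimpleCF.quotient-positive b 0)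
value-shift-positive b (suc i) = pos+pos⇒pos
  (fromℤ (quotient b 1)) {{fromℤ-positive {quotient b 1} (SimpleCF.quotient-positive b 0)}}
  ((1/ value (shift (shift b)) i)
    {{pos⇒nonZero (value (shift (shift b)) i) {{value-shift-positive (shift b) i}}}})
  {{1/pos⇒pos (value (shift (shift b)) i) {{value-shift-positive (shift b) i}}}}

_HasCF_ : ℝ → SimpleCF → Set
θ HasCF b = ConvergesTo (λ i → fromℚ (value b i)) θ

-- ℚ is kept in lowest terms with positive denominator, so numerator and
-- denominator are the coprime pair (pᵢ , qᵢ).
convergent : SimpleCF → ℕ → ℤ × ℤ
convergent b i = ↥ (value b i) , ↧ (value b i)

-- HasForm below describes
--   [ c₀ ; c₁ , … , c_{n₁} , a₀ , c_{n₁+1} , … , c_{n₁+n₂} , a₁ , … ]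
-- The block lengths n₁ , n₂ , … are given as ns 0 , ns 1 , …

-- n₁ + ⋯ + nⱼ
partialSum : (ℕ → ℕ) → ℕ → ℕ
partialSum ns zero    = 0
partialSum ns (suc j) = partialSum ns j ℕ.+ ns j

-- Iⱼ = n₁ + ⋯ + nⱼ₊₁ + j, so that aⱼ stands at position Iⱼ + 1.
leapingSubscript : (ℕ → ℕ) → ℕ → ℕ
leapingSubscript ns j = partialSum ns (suc j) ℕ.+ j

-- If only finitely many block lengths are nonzero, c continues with values
-- that do not occur in the continued fraction.
record HasForm (b : SimpleCF) (c a : ℕ → ℤ) (ns : ℕ → ℕ) : Set where
  field
    initial-term : quotient b 0 ≡ c 0
    block-term   : ∀ j t → 1 ℕ.≤ t → t ℕ.≤ ns j →
                   quotient b (partialSum ns j ℕ.+ j ℕ.+ t) ≡ c (partialSum ns j ℕ.+ t)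
    leap-term    : ∀ j → quotient b (suc (leapingSubscript ns j)) ≡ a j

leaper : SimpleCF → (ℕ → ℕ) → ℕ → ℤ × ℤ
leaper b ns j = convergent b (leapingSubscript ns j)

TendsToInfinity : (ℕ → ℤ) → Set
TendsToInfinity a = ∀ M → ∃ λ J → ∀ j → J ℕ.≤ j → M ℤ.≤ a j

Bounded : (ℕ → ℤ) → Set
Bounded c = ∃ λ B → ∀ i → ℤ.∣ c i ∣ ℕ.≤ B

infix 4 _≈_[mod_] _≈₂_[mod_]

_≈_[mod_] : ℤ → ℤ → ℕ → Set
i ≈ j [mod n ] = + n ∣ (i ℤ.- j)

_≈₂_[mod_] : ℤ × ℤ → ℤ × ℤ → ℕ → Set
(i , j) ≈₂ (k , l) [mod n ] = i ≈ k [mod n ] × j ≈ l [mod n ]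

_⊙_ : ℤ → ℤ × ℤ → ℤ × ℤ
g ⊙ (i , j) = g ℤ.* i , g ℤ.* j

InvertibleMod : ℕ → ℤ → Set
InvertibleMod n g = ∃ λ h → g ℤ.* h ≈ + 1 [mod n ]

InfinitelyMany : (ℕ → Set) → Set
InfinitelyMany P = ∀ J → ∃ λ j → J ℕ.≤ j × P j

{-# OPTIONS --safe #-}

-- With Q = nq − r and P = nz + m one has q‖qθ − φ‖ ≈ ∣Q∣ ∣Qθ − P∣ / n² for the best z, and
-- (P , Q) runs through the integer pairs congruent to (m , −r).  A pair making ∣Q∣ ∣Qθ − P∣ small
-- is, as in Legendre's theorem, a multiple x (pᵢ , qᵢ) of a convergent, and then
-- ∣Q∣ ∣Qθ − P∣ ≥ qᵢ ∣qᵢθ − pᵢ∣ ≥ 1 / (bᵢ₊₁ + 2) forces bᵢ₊₁ to be large, so i is a leaping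
-- subscript; gcd(r , m , n) = 1 makes x invertible.  Conversely a leaper times a multiplier in
-- [1 , n) gives ∣Q∣ ∣Qθ − P∣ ≤ n² / aⱼ.  All estimates are made with θ replaced by a far
-- convergent pₖ/qₖ, where they are inequalities between integers, and transferred to θ by
-- Lipschitz continuity for fixed q.
module Submission where

open import Defs
open import Data.Nat using (ℕ; NonZero) renaming (_≤_ to _≤ℕ_)
open import Data.Integer using (ℤ; +_; -_; _≤_; _<_)
open import Data.Integer.GCD using (gcd)
open import Data.Rational using (0ℚ; _/_)
open import Data.Rational.Literals using (fromℤ)
open import Data.Product using (∃; _×_; _,_)
open import Function.Bundles using (_⇔_)
open import Relation.Binary.PropositionalEquality using (_≡_)

open import Data.Empty using (⊥-elim)
open import Data.Integer as ℤ using (-[1+_]; ∣_∣)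
import Data.Integer.Divisibility as ℤᵤ
open import Data.Integer.Divisibility.Signed as ℤ∣ using (divides)
import Data.Integer.DivMod as ℤ-DivMod
open import Data.Integer.GCD using (gcd-greatest)
import Data.Integer.Properties as ℤₚ
open import Data.Integer.Tactic.RingSolver using (solve-∀)
open import Data.Nat as ℕ using (zero; suc; z≤n; s≤s)
import Data.Nat.Coprimality as Coprimality
open import Data.Nat.Coprimality using (Coprime)
import Data.Nat.Divisibility as ℕ∣
open import Data.Nat.GCD using (module Bézout)
import Data.Nat.Properties as ℕₚ
import Data.Nat.Tactic.RingSolver as ℕ-Solver
open import Data.Product using (∃₂; proj₁; proj₂)
open import Data.Rational as ℚ using (ℚ; mkℚ; ↥_; ↧_; ↧ₙ_; 1ℚ; ½; 1/_; *≡*; *≤*; *<*)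
import Data.Rational.Properties as ℚₚ
import Data.Rational.Solver as ℚ-Solver
import Data.Rational.Unnormalised as ℚᵘ
import Data.Rational.Unnormalised.Properties as ℚᵘₚ
open import Data.Sum using (_⊎_; inj₁; inj₂)
open import Function.Bundles using (mk⇔)
open import Relation.Binary.PropositionalEquality using (refl; sym; trans; cong; cong₂; subst; subst₂; module ≡-Reasoning)
open import Relation.Nullary using (yes; no)

-- Continuants

-- The far index k has to be chosen after q: the Lipschitz constant of the weighted distance grows
-- with ∣q∣, and k > ∣Q∣ is what places the convergent found by Legendre's argument before k. For
-- fixed k and v = pₖ/qₖ, the error of convergent i ≤ k is split into the sign (-1)^i and a natural
-- number `gap b i k`, and the single identity `den-split` yields both the upper and the lower
-- estimate of qᵢ ∣qᵢv - pᵢ∣.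
--
-- In the forward direction each J needs only one q. The tolerance is tuned to M = B + ∣a₀∣ + ⋯ +
-- ∣a_{J-1}∣, where B bounds c: a quotient above M is neither a block term nor one of the first J
-- leap terms, so the leaper found has index at least J. In the converse, reducing the multiplier
-- modulo n keeps it below n, and invertibility keeps it at least 1, so that ∣q∣ tends to infinity
-- with the leaper.

∣quotient∣ : SimpleCF → ℕ → ℕ
∣quotient∣ b i = ∣ quotient b i ∣

+∣quotient∣ : ∀ b i → + ∣quotient∣ b (suc i) ≡ quotient b (suc i)
+∣quotient∣ b i with quotient b (suc i) | SimpleCF.quotient-positive b i
... | ℤ.+[1+ _ ] | _ = refl

1≤∣quotient∣ : ∀ b i → 1 ℕ.≤ ∣quotient∣ b (suc i)
1≤∣quotient∣ b i with quotient b (suc i) | SimpleCF.quotient-positive b i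
... | ℤ.+[1+ _ ] | _ = s≤s z≤n

-- Euler's continuant K(b₁, ..., bᵢ), expanded from the front to match the recursion of `value`
-- through `shift`. The usual recurrence at the far end is `den-step`.
den : SimpleCF → ℕ → ℕ
den b zero          = 1
den b (suc zero)    = ∣quotient∣ b 1
den b (suc (suc i)) = ∣quotient∣ b 1 ℕ.* den (shift b) (suc i) ℕ.+ den (shift (shift b)) i

num : SimpleCF → ℕ → ℤ
num b zero    = quotient b 0
num b (suc i) = quotient b 0 ℤ.* + den b (suc i) ℤ.+ + den (shift b) i

-- Peeling off b₀ leaves the reciprocal of the tail, which exchanges numerator and denominator.
num-shift : ∀ b i → num (shift b) i ≡ + den b (suc i)
num-shift b zero    = sym (+∣quotient∣ b 0)
num-shift b (suc i) = begin
  quotient b 1 ℤ.* + d ℤ.+ + e           ≡⟨ cong (λ x → x ℤ.* + d ℤ.+ + e) (+∣quotient∣ b 0) ⟨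
  + ∣quotient∣ b 1 ℤ.* + d ℤ.+ + e       ≡⟨ cong (ℤ._+ + e) (ℤₚ.pos-* (∣quotient∣ b 1) d) ⟨
  + (∣quotient∣ b 1 ℕ.* d) ℤ.+ + e       ≡⟨ ℤₚ.pos-+ (∣quotient∣ b 1 ℕ.* d) e ⟨
  + den b (suc (suc i))                  ∎
  where
  open ≡-Reasoning
  d e : ℕ
  d = den (shift b) (suc i)
  e = den (shift (shift b)) i

-- A continuant expands equally from either end. The definition recurses through two tails, so the
-- induction uses the recurrence for both and needs two base cases.
den-step : ∀ b i → den b (2 ℕ.+ i) ≡ ∣quotient∣ b (2 ℕ.+ i) ℕ.* den b (suc i) ℕ.+ den b i
den-step b zero = cong (ℕ._+ 1) (ℕₚ.*-comm (∣quotient∣ b 1) (∣quotient∣ b 2))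
den-step b (suc zero) = trans
  (cong (λ x → ∣quotient∣ b 1 ℕ.* x ℕ.+ ∣quotient∣ b 3) (den-step (shift b) 0))
  (alg (∣quotient∣ b 1) (∣quotient∣ b 2) (∣quotient∣ b 3))
  where
  alg : ∀ x y z → x ℕ.* (z ℕ.* y ℕ.+ 1) ℕ.+ z ≡ z ℕ.* (x ℕ.* y ℕ.+ 1) ℕ.+ x
  alg = ℕ-Solver.solve-∀
den-step b (suc (suc i)) = trans
  (cong₂ (λ x y → ∣quotient∣ b 1 ℕ.* x ℕ.+ y)
    (den-step (shift b) (suc i)) (den-step (shift (shift b)) i))
  (alg (∣quotient∣ b 1) (∣quotient∣ b (4 ℕ.+ i)) _ _ _ _)
  where
  alg : ∀ x z s t u v → x ℕ.* (z ℕ.* s ℕ.+ t) ℕ.+ (z ℕ.* u ℕ.+ v)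
                      ≡ z ℕ.* (x ℕ.* s ℕ.+ u) ℕ.+ (x ℕ.* t ℕ.+ v)
  alg = ℕ-Solver.solve-∀

den>0 : ∀ b i → 0 ℕ.< den b i
den>0 b zero          = s≤s z≤n
den>0 b (suc zero)    = 1≤∣quotient∣ b 0
den>0 b (suc (suc i)) =
  ℕₚ.≤-trans (den>0 (shift (shift b)) i) (ℕₚ.m≤n+m _ (∣quotient∣ b 1 ℕ.* den (shift b) (suc i)))

den-nonZero : ∀ b i → ℕ.NonZero (den b i)
den-nonZero b i = ℕ.>-nonZero (den>0 b i)

m≤n*m : ∀ m {n} → 1 ℕ.≤ n → m ℕ.≤ n ℕ.* m
m≤n*m m {suc n} _ = ℕₚ.m≤m+n m (n ℕ.* m)

den-mono : ∀ b i → den b i ℕ.≤ den b (suc i)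
den-mono b zero    = 1≤∣quotient∣ b 0
den-mono b (suc i) = ℕₚ.≤-trans (m≤n*m (den b (suc i)) (1≤∣quotient∣ b (suc i)))
  (ℕₚ.≤-trans (ℕₚ.m≤m+n _ (den b i)) (ℕₚ.≤-reflexive (sym (den-step b i))))

den-shift≤ : ∀ b i → den (shift b) i ℕ.≤ den b (suc i)
den-shift≤ b zero    = 1≤∣quotient∣ b 0
den-shift≤ b (suc i) = ℕₚ.≤-trans (m≤n*m (den (shift b) (suc i)) (1≤∣quotient∣ b 0))
  (ℕₚ.m≤m+n _ (den (shift (shift b)) i))

den-growth : ∀ b i → i ℕ.≤ den b i
den-growth b zero          = z≤n
den-growth b (suc zero)    = 1≤∣quotient∣ b 0
den-growth b (suc (suc i)) = ℕₚ.≤-trans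
  (ℕₚ.≤-trans (ℕₚ.≤-reflexive (ℕₚ.+-comm 1 (suc i)))
    (ℕₚ.+-mono-≤ (ℕₚ.≤-trans (den-growth b (suc i))
      (m≤n*m (den b (suc i)) (1≤∣quotient∣ b (suc i)))) (den>0 b i)))
  (ℕₚ.≤-reflexive (sym (den-step b i)))

quotient*den≤den-suc : ∀ b i → ∣quotient∣ b (suc i) ℕ.* den b i ℕ.≤ den b (suc i)
quotient*den≤den-suc b zero    = ℕₚ.≤-reflexive (ℕₚ.*-identityʳ _)
quotient*den≤den-suc b (suc i) =
  ℕₚ.≤-trans (ℕₚ.m≤m+n _ (den b i)) (ℕₚ.≤-reflexive (sym (den-step b i)))

den-suc≤ : ∀ b i → den b (suc i) ℕ.≤ ∣quotient∣ b (suc i) ℕ.* den b i ℕ.+ den b i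
den-suc≤ b zero    = ℕₚ.≤-trans (ℕₚ.≤-reflexive (sym (ℕₚ.*-identityʳ _))) (ℕₚ.m≤m+n _ 1)
den-suc≤ b (suc i) = ℕₚ.≤-trans (ℕₚ.≤-reflexive (den-step b i))
  (ℕₚ.+-monoʳ-≤ (∣quotient∣ b (2 ℕ.+ i) ℕ.* den b (suc i)) (den-mono b i))

sgn : ℕ → ℤ
sgn zero    = + 1
sgn (suc i) = - sgn i

sgn² : ∀ i → sgn i ℤ.* sgn i ≡ + 1
sgn² zero    = refl
sgn² (suc i) = trans (alg (sgn i)) (sgn² i)
  where
  alg : ∀ s → (- s) ℤ.* (- s) ≡ s ℤ.* s
  alg = solve-∀

∣sgn∣ : ∀ i → ∣ sgn i ∣ ≡ 1
∣sgn∣ zero    = refl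
∣sgn∣ (suc i) = trans (ℤₚ.∣-i∣≡∣i∣ (sgn i)) (∣sgn∣ i)

-- For i ≤ k this is den k · ∣ den i · v − num i ∣ with v = [b₀; …, b_k].
gap : SimpleCF → ℕ → ℕ → ℕ
gap b i       zero    = 0
gap b zero    (suc k) = den (shift b) k
gap b (suc i) (suc k) = gap (shift b) i k

gap-suc : ∀ b i → gap b i (suc i) ≡ 1
gap-suc b zero    = refl
gap-suc b (suc i) = gap-suc (shift b) i

-- After i shifts this compares the continuants of two tails, one starting a place later than the
-- other.
gap-antimono : ∀ b i k → gap b (suc i) k ℕ.≤ gap b i k
gap-antimono b i       zero          = z≤n
gap-antimono b zero    (suc zero)    = z≤n
gap-antimono b zero    (suc (suc k)) = den-shift≤ (shift b) k
gap-antimono b (suc i) (suc k)       = gap-antimono (shift b) i k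

-- Removing b₀ cancels its contribution and swaps numerators with denominators, so each shift costs
-- one change of sign.
signed-gap : ∀ b {i k} → i ℕ.≤ k →
  + den b i ℤ.* num b k ℤ.- num b i ℤ.* + den b k ≡ sgn i ℤ.* + gap b i k
signed-gap b {zero} {zero} _ = alg (quotient b 0)
  where
  alg : ∀ x → + 1 ℤ.* x ℤ.- x ℤ.* + 1 ≡ + 0
  alg = solve-∀
signed-gap b {zero} {suc k} _ = alg (quotient b 0) (+ den b (suc k)) (+ den (shift b) k)
  where
  alg : ∀ x y z → + 1 ℤ.* (x ℤ.* y ℤ.+ z) ℤ.- x ℤ.* y ≡ + 1 ℤ.* z
  alg = solve-∀
signed-gap b {suc i} {suc k} (s≤s i≤k) = begin
  + den b (suc i) ℤ.* num b (suc k) ℤ.- num b (suc i) ℤ.* + den b (suc k)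
    ≡⟨ alg (quotient b 0) (+ den b (suc i)) (+ den (shift b) k) (+ den (shift b) i) (+ den b (suc k)) ⟩
  - (+ den (shift b) i ℤ.* + den b (suc k) ℤ.- + den b (suc i) ℤ.* + den (shift b) k)
    ≡⟨ cong₂ (λ x y → - (+ den (shift b) i ℤ.* x ℤ.- y ℤ.* + den (shift b) k))
         (num-shift b k) (num-shift b i) ⟨
  - (+ den (shift b) i ℤ.* num (shift b) k ℤ.- num (shift b) i ℤ.* + den (shift b) k)
    ≡⟨ cong -_ (signed-gap (shift b) i≤k) ⟩
  - (sgn i ℤ.* + gap (shift b) i k)
    ≡⟨ ℤₚ.neg-distribˡ-* (sgn i) (+ gap (shift b) i k) ⟩
  sgn (suc i) ℤ.* + gap b (suc i) (suc k) ∎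
  where
  open ≡-Reasoning
  alg : ∀ x di ek ei dk → di ℤ.* (x ℤ.* dk ℤ.+ ek) ℤ.- (x ℤ.* di ℤ.+ ei) ℤ.* dk
                        ≡ - (ei ℤ.* dk ℤ.- di ℤ.* ek)
  alg = solve-∀

∣signed-gap∣ : ∀ b {i k} → i ℕ.≤ k →
  ∣ + den b i ℤ.* num b k ℤ.- num b i ℤ.* + den b k ∣ ≡ gap b i k
∣signed-gap∣ b {i} {k} i≤k = begin
  ∣ + den b i ℤ.* num b k ℤ.- num b i ℤ.* + den b k ∣ ≡⟨ cong ∣_∣ (signed-gap b i≤k) ⟩
  ∣ sgn i ℤ.* + gap b i k ∣                           ≡⟨ ℤₚ.abs-* (sgn i) (+ gap b i k) ⟩
  ∣ sgn i ∣ ℕ.* gap b i k                             ≡⟨ cong (ℕ._* gap b i k) (∣sgn∣ i) ⟩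
  1 ℕ.* gap b i k                                     ≡⟨ ℕₚ.*-identityˡ _ ⟩
  gap b i k                                           ∎
  where open ≡-Reasoning

determinant : ∀ b i → + den b i ℤ.* num b (suc i) ℤ.- num b i ℤ.* + den b (suc i) ≡ sgn i
determinant b i = trans (signed-gap b (ℕₚ.n≤1+n i))
  (trans (cong (λ g → sgn i ℤ.* + g) (gap-suc b i)) (ℤₚ.*-identityʳ (sgn i)))

-- This is 1 = q_{i+1} ∣qᵢv - pᵢ∣ + qᵢ ∣q_{i+1}v - p_{i+1}∣ multiplied by qₖ: v is eliminated from
-- two consecutive errors by the determinant, and their opposite signs turn the difference into a
-- sum.
den-split : ∀ b {i k} → i ℕ.< k →
  den b k ≡ den b (suc i) ℕ.* gap b i k ℕ.+ den b i ℕ.* gap b (suc i) k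
den-split b {i} {k} i<k = ℤₚ.+-injective (begin
  + dk                                        ≡⟨ ℤₚ.*-identityˡ (+ dk) ⟨
  + 1 ℤ.* + dk                                ≡⟨ cong (ℤ._* + dk) (sgn² i) ⟨
  s ℤ.* s ℤ.* + dk                            ≡⟨ cong (λ z → s ℤ.* z ℤ.* + dk) (determinant b i) ⟨
  s ℤ.* (+ di ℤ.* num b (suc i) ℤ.- num b i ℤ.* + di′) ℤ.* + dk
    ≡⟨ alg s (+ di) (+ di′) (num b i) (num b (suc i)) (+ dk) (num b k) ⟩
  s ℤ.* (+ di′ ℤ.* (+ di ℤ.* num b k ℤ.- num b i ℤ.* + dk)
     ℤ.- + di ℤ.* (+ di′ ℤ.* num b k ℤ.- num b (suc i) ℤ.* + dk))
    ≡⟨ cong₂ (λ x y → s ℤ.* (+ di′ ℤ.* x ℤ.- + di ℤ.* y))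
         (signed-gap b (ℕₚ.<⇒≤ i<k)) (signed-gap b i<k) ⟩
  s ℤ.* (+ di′ ℤ.* (s ℤ.* + g) ℤ.- + di ℤ.* ((- s) ℤ.* + g′))
    ≡⟨ alg′ s (+ di) (+ di′) (+ g) (+ g′) ⟩
  s ℤ.* s ℤ.* (+ di′ ℤ.* + g ℤ.+ + di ℤ.* + g′)
    ≡⟨ cong (ℤ._* (+ di′ ℤ.* + g ℤ.+ + di ℤ.* + g′)) (sgn² i) ⟩
  + 1 ℤ.* (+ di′ ℤ.* + g ℤ.+ + di ℤ.* + g′)   ≡⟨ ℤₚ.*-identityˡ _ ⟩
  + di′ ℤ.* + g ℤ.+ + di ℤ.* + g′             ≡⟨ cong₂ ℤ._+_ (ℤₚ.pos-* di′ g) (ℤₚ.pos-* di g′) ⟨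
  + (di′ ℕ.* g) ℤ.+ + (di ℕ.* g′)             ≡⟨ ℤₚ.pos-+ (di′ ℕ.* g) (di ℕ.* g′) ⟨
  + (di′ ℕ.* g ℕ.+ di ℕ.* g′)                 ∎)
  where
  open ≡-Reasoning
  s : ℤ
  s = sgn i
  di di′ dk g g′ : ℕ
  di = den b i
  di′ = den b (suc i)
  dk = den b k
  g = gap b i k
  g′ = gap b (suc i) k
  alg : ∀ s d d′ n n′ e m → s ℤ.* (d ℤ.* n′ ℤ.- n ℤ.* d′) ℤ.* e
      ≡ s ℤ.* (d′ ℤ.* (d ℤ.* m ℤ.- n ℤ.* e) ℤ.- d ℤ.* (d′ ℤ.* m ℤ.- n′ ℤ.* e))
  alg = solve-∀
  alg′ : ∀ s d d′ g g′ → s ℤ.* (d′ ℤ.* (s ℤ.* g) ℤ.- d ℤ.* ((- s) ℤ.* g′))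
       ≡ s ℤ.* s ℤ.* (d′ ℤ.* g ℤ.+ d ℤ.* g′)
  alg′ = solve-∀

quotient*den*gap≤den : ∀ b {i k} → i ℕ.< k →
  ∣quotient∣ b (suc i) ℕ.* (den b i ℕ.* gap b i k) ℕ.≤ den b k
quotient*den*gap≤den b {i} {k} i<k = begin
  ∣quotient∣ b (suc i) ℕ.* (den b i ℕ.* gap b i k)              ≡⟨ ℕₚ.*-assoc (∣quotient∣ b (suc i)) (den b i) _ ⟨
  ∣quotient∣ b (suc i) ℕ.* den b i ℕ.* gap b i k                ≤⟨ ℕₚ.*-monoˡ-≤ (gap b i k) (quotient*den≤den-suc b i) ⟩
  den b (suc i) ℕ.* gap b i k                                   ≤⟨ ℕₚ.m≤m+n _ _ ⟩
  den b (suc i) ℕ.* gap b i k ℕ.+ den b i ℕ.* gap b (suc i) k   ≡⟨ den-split b i<k ⟨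
  den b k                                                       ∎
  where open ℕₚ.≤-Reasoning

-- Of the 2, one unit comes from q_{i+1} ≤ (b_{i+1} + 1) qᵢ and the other from the second term of
-- `den-split`, since the gaps decrease.
den≤quotient*den*gap : ∀ b {i k} → i ℕ.< k →
  den b k ℕ.≤ (2 ℕ.+ ∣quotient∣ b (suc i)) ℕ.* (den b i ℕ.* gap b i k)
den≤quotient*den*gap b {i} {k} i<k = begin
  den b k                                                       ≡⟨ den-split b i<k ⟩
  den b (suc i) ℕ.* g ℕ.+ den b i ℕ.* gap b (suc i) k           ≤⟨ ℕₚ.+-mono-≤
    (ℕₚ.*-monoˡ-≤ g (den-suc≤ b i)) (ℕₚ.*-monoʳ-≤ (den b i) (gap-antimono b i k)) ⟩
  (x ℕ.* den b i ℕ.+ den b i) ℕ.* g ℕ.+ den b i ℕ.* g           ≡⟨ alg x (den b i) g ⟩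
  (2 ℕ.+ x) ℕ.* (den b i ℕ.* g)                                 ∎
  where
  open ℕₚ.≤-Reasoning
  g x : ℕ
  g = gap b i k
  x = ∣quotient∣ b (suc i)
  alg : ∀ x d g → (x ℕ.* d ℕ.+ d) ℕ.* g ℕ.+ d ℕ.* g ≡ (2 ℕ.+ x) ℕ.* (d ℕ.* g)
  alg = ℕ-Solver.solve-∀

-- Legendre's theorem

den-bracket : ∀ b {Q} → 1 ℕ.≤ Q → ∃ λ i → den b i ℕ.≤ Q × Q ℕ.< den b (suc i)
-- Denominator number Q + 1 already exceeds Q; the downward search must stop because `den b 0` is 1.
den-bracket b {Q} 1≤Q = search (suc Q) (den-growth b (suc Q))
  where
  search : ∀ j → Q ℕ.< den b j → ∃ λ i → den b i ℕ.≤ Q × Q ℕ.< den b (suc i)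
  search zero    Q<1 = ⊥-elim (ℕₚ.<⇒≱ Q<1 1≤Q)
  search (suc j) Q<d with den b j ℕ.≤? Q
  ... | yes d≤Q = j , d≤Q , Q<d
  ... | no  d≰Q = search j (ℕₚ.≰⇒> d≰Q)

-- A nonzero y forces x to have the opposite sign, so that the two terms of x g − y g′ add up.
opposite-signs : ∀ x y {d d′ Q} g g′ → + Q ≡ x ℤ.* + d ℤ.+ y ℤ.* + d′ → Q ℕ.< d′ →
  y ≡ + 0 ⊎ g ℕ.≤ ∣ x ℤ.* + g ℤ.- y ℤ.* + g′ ∣
opposite-signs x (+ zero) g g′ eq Q<d′ = inj₁ refl
opposite-signs (+ x) ℤ.+[1+ y ] {d} {d′} {Q} g g′ eq Q<d′ = ⊥-elim (ℕₚ.<⇒≱ Q<d′ (begin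
  d′                                ≤⟨ ℕₚ.m≤m+n d′ (y ℕ.* d′) ⟩
  suc y ℕ.* d′                      ≤⟨ ℕₚ.m≤n+m _ (x ℕ.* d) ⟩
  x ℕ.* d ℕ.+ suc y ℕ.* d′          ≡⟨ ℤₚ.+-injective (trans eq (cong₂ ℤ._+_ (sym (ℤₚ.pos-* x d)) (sym (ℤₚ.pos-* (suc y) d′)))) ⟨
  Q                                 ∎))
  where open ℕₚ.≤-Reasoning
opposite-signs -[1+ x ] ℤ.+[1+ y ] {d} {d′} {Q} g g′ eq Q<d′ = inj₂ (begin
  g                                      ≤⟨ ℕₚ.m≤m+n g (x ℕ.* g) ⟩
  suc x ℕ.* g                            ≤⟨ ℕₚ.m≤m+n _ (suc y ℕ.* g′) ⟩
  suc x ℕ.* g ℕ.+ suc y ℕ.* g′           ≡⟨ cong ∣_∣ (cong₂ ℤ._+_ (ℤₚ.pos-* (suc x) g) (ℤₚ.pos-* (suc y) g′)) ⟩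
  ∣ + suc x ℤ.* + g ℤ.+ + suc y ℤ.* + g′ ∣ ≡⟨ ℤₚ.∣-i∣≡∣i∣ (+ suc x ℤ.* + g ℤ.+ + suc y ℤ.* + g′) ⟨
  ∣ - (+ suc x ℤ.* + g ℤ.+ + suc y ℤ.* + g′) ∣ ≡⟨ cong ∣_∣ (alg (+ suc x) (+ suc y) (+ g) (+ g′)) ⟩
  ∣ -[1+ x ] ℤ.* + g ℤ.- + suc y ℤ.* + g′ ∣ ∎)
  where
  open ℕₚ.≤-Reasoning
  alg : ∀ x y g g′ → - (x ℤ.* g ℤ.+ y ℤ.* g′) ≡ (- x) ℤ.* g ℤ.- y ℤ.* g′
  alg = solve-∀
opposite-signs -[1+ x ] -[1+ y ] {d} {d′} {Q} g g′ eq Q<d′ = ⊥-elim (ℕₚ.<⇒≱ Q<d′ (begin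
  d′                                ≤⟨ ℕₚ.m≤m+n d′ (y ℕ.* d′) ⟩
  suc y ℕ.* d′                      ≤⟨ ℕₚ.m≤n+m _ (suc x ℕ.* d) ⟩
  suc x ℕ.* d ℕ.+ suc y ℕ.* d′      ≤⟨ ℕₚ.m≤n+m _ Q ⟩
  Q ℕ.+ (suc x ℕ.* d ℕ.+ suc y ℕ.* d′)
    ≡⟨ ℤₚ.+-injective (trans (cong (λ z → + Q ℤ.+ z) (cong₂ ℤ._+_ (ℤₚ.pos-* (suc x) d) (ℤₚ.pos-* (suc y) d′)))
         (trans (cong (ℤ._+ (+ suc x ℤ.* + d ℤ.+ + suc y ℤ.* + d′)) eq) (alg (+ suc x) (+ suc y) (+ d) (+ d′)))) ⟩
  0                                 ≤⟨ z≤n ⟩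
  Q                                 ∎))
  where
  open ℕₚ.≤-Reasoning
  alg : ∀ x y d d′ → ((- x) ℤ.* d ℤ.+ (- y) ℤ.* d′) ℤ.+ (x ℤ.* d ℤ.+ y ℤ.* d′) ≡ + 0
  alg = solve-∀
-- Here + Q would equal a negative multiple of d′. Since Q < d′ excludes d′ = 0, matching `suc d′`
-- makes the product reduce to a negative constructor.
opposite-signs (+ zero) -[1+ y ] {d} {suc d′} {Q} g g′ eq Q<d′ with trans eq (alg (-[1+ y ] ℤ.* + suc d′) (+ d))
  where
  alg : ∀ z d → + 0 ℤ.* d ℤ.+ z ≡ z
  alg = solve-∀
... | ()
opposite-signs ℤ.+[1+ x ] -[1+ y ] {d} {d′} {Q} g g′ eq Q<d′ = inj₂ (begin
  g                                      ≤⟨ ℕₚ.m≤m+n g (x ℕ.* g) ⟩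
  suc x ℕ.* g                            ≤⟨ ℕₚ.m≤m+n _ (suc y ℕ.* g′) ⟩
  suc x ℕ.* g ℕ.+ suc y ℕ.* g′           ≡⟨ cong ∣_∣ (cong₂ ℤ._+_ (ℤₚ.pos-* (suc x) g) (ℤₚ.pos-* (suc y) g′)) ⟩
  ∣ + suc x ℤ.* + g ℤ.+ + suc y ℤ.* + g′ ∣ ≡⟨ cong ∣_∣ (alg (+ suc x) (+ suc y) (+ g) (+ g′)) ⟩
  ∣ + suc x ℤ.* + g ℤ.- -[1+ y ] ℤ.* + g′ ∣ ∎)
  where
  open ℕₚ.≤-Reasoning
  alg : ∀ x y g g′ → x ℤ.* g ℤ.+ y ℤ.* g′ ≡ x ℤ.* g ℤ.- (- y) ℤ.* g′
  alg = solve-∀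

-- Write (P , Q) as x times convergent i plus y times convergent i + 1.  If y ≠ 0 then, with
-- E = Q pₖ − P qₖ, one would have qₖ ≤ ∣ P qᵢ − Q pᵢ ∣ qₖ ≤ 2 Q ∣ E ∣.
good-approximation⇒multiple : ∀ b {i k Q} P → den b i ℕ.≤ Q → Q ℕ.< den b (suc i) → i ℕ.< k →
  3 ℕ.* (Q ℕ.* ∣ + Q ℤ.* num b k ℤ.- P ℤ.* + den b k ∣) ℕ.≤ den b k →
  ∃ λ x → P ≡ x ℤ.* num b i × + Q ≡ x ℤ.* + den b i
good-approximation⇒multiple b {i} {k} {Q} P d≤Q Q<d′ i<k small = x , P≡ , Q≡
  where
  s E p p′ d d′ x y : ℤ
  s = sgn i
  E = + Q ℤ.* num b k ℤ.- P ℤ.* + den b k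
  p = num b i
  p′ = num b (suc i)
  d = + den b i
  d′ = + den b (suc i)
  -- Cramer's rule: the determinant is s = ±1, so multiplying by s divides by it and the coordinates
  -- are integers.
  x = s ℤ.* (+ Q ℤ.* p′ ℤ.- P ℤ.* d′)
  y = s ℤ.* (P ℤ.* d ℤ.- + Q ℤ.* p)

  cancel : ∀ z → s ℤ.* (d ℤ.* p′ ℤ.- p ℤ.* d′) ℤ.* z ≡ z
  cancel z = trans (cong (λ u → s ℤ.* u ℤ.* z) (determinant b i))
    (trans (cong (ℤ._* z) (sgn² i)) (ℤₚ.*-identityˡ z))

  Q≡′ : + Q ≡ x ℤ.* d ℤ.+ y ℤ.* d′
  Q≡′ = trans (sym (cancel (+ Q))) (alg s (+ Q) P p p′ d d′)
    where
    alg : ∀ s Q P p p′ d d′ → s ℤ.* (d ℤ.* p′ ℤ.- p ℤ.* d′) ℤ.* Q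
      ≡ s ℤ.* (Q ℤ.* p′ ℤ.- P ℤ.* d′) ℤ.* d ℤ.+ s ℤ.* (P ℤ.* d ℤ.- Q ℤ.* p) ℤ.* d′
    alg = solve-∀

  P≡′ : P ≡ x ℤ.* p ℤ.+ y ℤ.* p′
  P≡′ = trans (sym (cancel P)) (alg s (+ Q) P p p′ d d′)
    where
    alg : ∀ s Q P p p′ d d′ → s ℤ.* (d ℤ.* p′ ℤ.- p ℤ.* d′) ℤ.* P
      ≡ s ℤ.* (Q ℤ.* p′ ℤ.- P ℤ.* d′) ℤ.* p ℤ.+ s ℤ.* (P ℤ.* d ℤ.- Q ℤ.* p) ℤ.* p′
    alg = solve-∀

  E≡ : E ≡ s ℤ.* (x ℤ.* + gap b i k ℤ.- y ℤ.* + gap b (suc i) k)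
  E≡ = begin
    E ≡⟨ cong₂ (λ Q P → Q ℤ.* num b k ℤ.- P ℤ.* + den b k) Q≡′ P≡′ ⟩
    (x ℤ.* d ℤ.+ y ℤ.* d′) ℤ.* num b k ℤ.- (x ℤ.* p ℤ.+ y ℤ.* p′) ℤ.* + den b k
      ≡⟨ alg x y p p′ d d′ (num b k) (+ den b k) ⟩
    x ℤ.* (d ℤ.* num b k ℤ.- p ℤ.* + den b k) ℤ.+ y ℤ.* (d′ ℤ.* num b k ℤ.- p′ ℤ.* + den b k)
      ≡⟨ cong₂ (λ u v → x ℤ.* u ℤ.+ y ℤ.* v) (signed-gap b (ℕₚ.<⇒≤ i<k)) (signed-gap b i<k) ⟩
    x ℤ.* (s ℤ.* + gap b i k) ℤ.+ y ℤ.* ((- s) ℤ.* + gap b (suc i) k)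
      ≡⟨ alg′ x y s (+ gap b i k) (+ gap b (suc i) k) ⟩
    s ℤ.* (x ℤ.* + gap b i k ℤ.- y ℤ.* + gap b (suc i) k) ∎
    where
    open ≡-Reasoning
    alg : ∀ x y p p′ d d′ n e → (x ℤ.* d ℤ.+ y ℤ.* d′) ℤ.* n ℤ.- (x ℤ.* p ℤ.+ y ℤ.* p′) ℤ.* e
      ≡ x ℤ.* (d ℤ.* n ℤ.- p ℤ.* e) ℤ.+ y ℤ.* (d′ ℤ.* n ℤ.- p′ ℤ.* e)
    alg = solve-∀
    alg′ : ∀ x y s g g′ → x ℤ.* (s ℤ.* g) ℤ.+ y ℤ.* ((- s) ℤ.* g′) ≡ s ℤ.* (x ℤ.* g ℤ.- y ℤ.* g′)
    alg′ = solve-∀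

  ∣s*∣ : ∀ z → ∣ s ℤ.* z ∣ ≡ ∣ z ∣
  ∣s*∣ z = trans (ℤₚ.abs-* s z) (trans (cong (ℕ._* ∣ z ∣) (∣sgn∣ i)) (ℕₚ.*-identityˡ ∣ z ∣))

  y≡0-or-gap≤ : y ≡ + 0 ⊎ gap b i k ℕ.≤ ∣ E ∣
  y≡0-or-gap≤ with opposite-signs x y {den b i} {den b (suc i)} {Q} (gap b i k) (gap b (suc i) k) Q≡′ Q<d′
  ... | inj₁ y≡0 = inj₁ y≡0
  ... | inj₂ g≤  = inj₂ (ℕₚ.≤-trans g≤
          (ℕₚ.≤-reflexive (sym (trans (cong ∣_∣ E≡) (∣s*∣ (x ℤ.* + gap b i k ℤ.- y ℤ.* + gap b (suc i) k))))))

  -- Eliminating v between the error of convergent i and E leaves two terms, Q times the gap and qᵢ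
  -- ∣E∣, each at most Q ∣E∣.
  ∣y∣≤ : gap b i k ℕ.≤ ∣ E ∣ → den b k ℕ.* ∣ y ∣ ℕ.≤ 2 ℕ.* (Q ℕ.* ∣ E ∣)
  ∣y∣≤ g≤E = begin
    den b k ℕ.* ∣ y ∣                              ≡⟨ cong (den b k ℕ.*_) (∣s*∣ (P ℤ.* d ℤ.- + Q ℤ.* p)) ⟩
    den b k ℕ.* ∣ P ℤ.* d ℤ.- + Q ℤ.* p ∣          ≡⟨ ℤₚ.abs-* (+ den b k) (P ℤ.* d ℤ.- + Q ℤ.* p) ⟨
    ∣ + den b k ℤ.* (P ℤ.* d ℤ.- + Q ℤ.* p) ∣      ≡⟨ cong ∣_∣ (alg (+ Q) P p d (num b k) (+ den b k)) ⟩
    ∣ + Q ℤ.* (d ℤ.* num b k ℤ.- p ℤ.* + den b k) ℤ.- d ℤ.* E ∣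
      ≤⟨ ℤₚ.∣i-j∣≤∣i∣+∣j∣ (+ Q ℤ.* (d ℤ.* num b k ℤ.- p ℤ.* + den b k)) (d ℤ.* E) ⟩
    ∣ + Q ℤ.* (d ℤ.* num b k ℤ.- p ℤ.* + den b k) ∣ ℕ.+ ∣ d ℤ.* E ∣
      ≡⟨ cong₂ ℕ._+_ (trans (ℤₚ.abs-* (+ Q) (d ℤ.* num b k ℤ.- p ℤ.* + den b k)) (cong (Q ℕ.*_) (∣signed-gap∣ b (ℕₚ.<⇒≤ i<k)))) (ℤₚ.abs-* d E) ⟩
    Q ℕ.* gap b i k ℕ.+ den b i ℕ.* ∣ E ∣          ≤⟨ ℕₚ.+-mono-≤ (ℕₚ.*-monoʳ-≤ Q g≤E) (ℕₚ.*-monoˡ-≤ ∣ E ∣ d≤Q) ⟩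
    Q ℕ.* ∣ E ∣ ℕ.+ Q ℕ.* ∣ E ∣                    ≡⟨ cong (Q ℕ.* ∣ E ∣ ℕ.+_) (ℕₚ.+-identityʳ (Q ℕ.* ∣ E ∣)) ⟨
    2 ℕ.* (Q ℕ.* ∣ E ∣)                            ∎
    where
    open ℕₚ.≤-Reasoning
    alg : ∀ Q P p d n e → e ℤ.* (P ℤ.* d ℤ.- Q ℤ.* p)
      ≡ Q ℤ.* (d ℤ.* n ℤ.- p ℤ.* e) ℤ.- d ℤ.* (Q ℤ.* n ℤ.- P ℤ.* e)
    alg = solve-∀

  -- A nonzero z would give 3S ≤ e ≤ e z ≤ 2S, hence S = 0 and then e = 0. This is where the
  -- constant 3 has to exceed 2.
  too-small : ∀ {e S} → 0 ℕ.< e → 3 ℕ.* S ℕ.≤ e → ∀ z → e ℕ.* z ℕ.≤ 2 ℕ.* S → z ≡ 0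
  too-small _ _ zero _ = refl
  too-small {e} {S} 0<e 3S≤e (suc z) ez≤2S = ⊥-elim (ℕₚ.<⇒≱ 0<e
    (ℕₚ.+-cancelʳ-≤ (2 ℕ.* S) e 0 (begin
      e ℕ.+ 2 ℕ.* S          ≤⟨ ℕₚ.+-monoˡ-≤ (2 ℕ.* S) e≤2S ⟩
      2 ℕ.* S ℕ.+ 2 ℕ.* S    ≤⟨ S+2S≤ ⟩
      2 ℕ.* S                ∎)))
    where
    open ℕₚ.≤-Reasoning
    e≤2S : e ℕ.≤ 2 ℕ.* S
    e≤2S = ℕₚ.≤-trans (ℕₚ.m≤m*n e (suc z)) ez≤2S
    S≡0 : S ℕ.≤ 0
    S≡0 = ℕₚ.+-cancelʳ-≤ (2 ℕ.* S) S 0 (ℕₚ.≤-trans 3S≤e e≤2S)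
    S+2S≤ : 2 ℕ.* S ℕ.+ 2 ℕ.* S ℕ.≤ 2 ℕ.* S
    S+2S≤ = ℕₚ.+-monoˡ-≤ (2 ℕ.* S) (ℕₚ.*-monoʳ-≤ 2 S≡0)

  y≡0 : y ≡ + 0
  y≡0 with y≡0-or-gap≤
  ... | inj₁ eq = eq
  ... | inj₂ g≤E = ℤₚ.∣i∣≡0⇒i≡0 (too-small {S = Q ℕ.* ∣ E ∣} (den>0 b k) small ∣ y ∣ (∣y∣≤ g≤E))

  drop-y : ∀ u v → x ℤ.* u ℤ.+ y ℤ.* v ≡ x ℤ.* u
  drop-y u v = trans (cong (λ y → x ℤ.* u ℤ.+ y ℤ.* v) y≡0) (ℤₚ.+-identityʳ (x ℤ.* u))

  P≡ : P ≡ x ℤ.* p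
  P≡ = trans P≡′ (drop-y p p′)

  Q≡ : + Q ≡ x ℤ.* d
  Q≡ = trans Q≡′ (drop-y d d′)

-- With x ≠ 0 both Q and ∣E∣ are at least their values at x = 1, so qₖ ≤ (2 + b_{i+1}) Q ∣E∣.
-- Writing 3 + M as 2 + (M + 1), cancelling Q ∣E∣ leaves the claim; that product is nonzero because
-- qₖ is.
multiple-bound : ∀ b {i k Q P x M} → i ℕ.< k → 1 ℕ.≤ Q → P ≡ x ℤ.* num b i → + Q ≡ x ℤ.* + den b i →
  (3 ℕ.+ M) ℕ.* (Q ℕ.* ∣ + Q ℤ.* num b k ℤ.- P ℤ.* + den b k ∣) ℕ.≤ den b k →
  M ℕ.< ∣quotient∣ b (suc i)
multiple-bound b {i} {k} {Q} {P} {x} {M} i<k 1≤Q P≡ Q≡ small = ℕₚ.+-cancelˡ-≤ 2 (suc M) _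
  (ℕₚ.*-cancelʳ-≤ (2 ℕ.+ suc M) (2 ℕ.+ ∣quotient∣ b (suc i)) S {{S-nonZero}} (begin
    (3 ℕ.+ M) ℕ.* S                                                 ≤⟨ small ⟩
    den b k                                                         ≤⟨ dk≤ ⟩
    (2 ℕ.+ ∣quotient∣ b (suc i)) ℕ.* S                              ∎))
  where
  open ℕₚ.≤-Reasoning
  E : ℤ
  E = + Q ℤ.* num b k ℤ.- P ℤ.* + den b k
  S : ℕ
  S = Q ℕ.* ∣ E ∣
  ∣E∣≡ : ∣ E ∣ ≡ ∣ x ∣ ℕ.* gap b i k
  ∣E∣≡ = begin-equality
    ∣ E ∣ ≡⟨ cong₂ (λ Q P → ∣ Q ℤ.* num b k ℤ.- P ℤ.* + den b k ∣) Q≡ P≡ ⟩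
    ∣ x ℤ.* + den b i ℤ.* num b k ℤ.- x ℤ.* num b i ℤ.* + den b k ∣
      ≡⟨ cong ∣_∣ (alg x (+ den b i) (num b k) (num b i) (+ den b k)) ⟩
    ∣ x ℤ.* (+ den b i ℤ.* num b k ℤ.- num b i ℤ.* + den b k) ∣
      ≡⟨ ℤₚ.abs-* x (+ den b i ℤ.* num b k ℤ.- num b i ℤ.* + den b k) ⟩
    ∣ x ∣ ℕ.* ∣ + den b i ℤ.* num b k ℤ.- num b i ℤ.* + den b k ∣
      ≡⟨ cong (∣ x ∣ ℕ.*_) (∣signed-gap∣ b (ℕₚ.<⇒≤ i<k)) ⟩
    ∣ x ∣ ℕ.* gap b i k ∎
    where
    alg : ∀ x d n p e → x ℤ.* d ℤ.* n ℤ.- x ℤ.* p ℤ.* e ≡ x ℤ.* (d ℤ.* n ℤ.- p ℤ.* e)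
    alg = solve-∀
  Q≡∣x∣d : Q ≡ ∣ x ∣ ℕ.* den b i
  Q≡∣x∣d = trans (cong ∣_∣ Q≡) (ℤₚ.abs-* x (+ den b i))
  1≤∣x∣ : 1 ℕ.≤ ∣ x ∣
  1≤∣x∣ = nonZero-factor ∣ x ∣ (subst (1 ℕ.≤_) Q≡∣x∣d 1≤Q)
    where
    nonZero-factor : ∀ n → 1 ℕ.≤ n ℕ.* den b i → 1 ℕ.≤ n
    nonZero-factor (suc n) _ = s≤s z≤n
  dg≤S : den b i ℕ.* gap b i k ℕ.≤ S
  dg≤S = ℕₚ.*-mono-≤
    (ℕₚ.≤-trans (m≤n*m (den b i) 1≤∣x∣) (ℕₚ.≤-reflexive (sym Q≡∣x∣d)))
    (ℕₚ.≤-trans (m≤n*m (gap b i k) 1≤∣x∣) (ℕₚ.≤-reflexive (sym ∣E∣≡)))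
  dk≤ : den b k ℕ.≤ (2 ℕ.+ ∣quotient∣ b (suc i)) ℕ.* S
  dk≤ = ℕₚ.≤-trans (den≤quotient*den*gap b i<k) (ℕₚ.*-monoʳ-≤ (2 ℕ.+ ∣quotient∣ b (suc i)) dg≤S)
  S-nonZero : ℕ.NonZero S
  S-nonZero = ℕₚ.m*n≢0⇒n≢0 (2 ℕ.+ ∣quotient∣ b (suc i)) {{ℕ.>-nonZero (ℕₚ.≤-trans (den>0 b k) dk≤)}}

pos-multiple-of-convergent : ∀ b {k} P {Q M} → 1 ℕ.≤ Q → Q ℕ.< k →
  (3 ℕ.+ M) ℕ.* (Q ℕ.* ∣ + Q ℤ.* num b k ℤ.- P ℤ.* + den b k ∣) ℕ.≤ den b k →
  ∃₂ λ i x → M ℕ.< ∣quotient∣ b (suc i) × P ≡ x ℤ.* num b i × + Q ≡ x ℤ.* + den b i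
pos-multiple-of-convergent b {k} P {Q} {M} 1≤Q Q<k small =
  let i , d≤Q , Q<d′ = den-bracket b 1≤Q
      -- i ≤ qᵢ ≤ Q < k, which is the purpose of asking for Q < k.
      i<k = ℕₚ.≤-<-trans (ℕₚ.≤-trans (den-growth b i) d≤Q) Q<k
      x , P≡ , Q≡ = good-approximation⇒multiple b P d≤Q Q<d′ i<k
        (ℕₚ.≤-trans (ℕₚ.*-monoˡ-≤ (Q ℕ.* ∣ + Q ℤ.* num b k ℤ.- P ℤ.* + den b k ∣) (ℕₚ.m≤m+n 3 M)) small)
  in i , x , multiple-bound b {i} {k} {Q} {P} {x} {M} i<k 1≤Q P≡ Q≡ small , P≡ , Q≡

multiple-of-convergent : ∀ b {k} P Q {M} → 1 ℕ.≤ ∣ Q ∣ → ∣ Q ∣ ℕ.< k →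
  (3 ℕ.+ M) ℕ.* (∣ Q ∣ ℕ.* ∣ Q ℤ.* num b k ℤ.- P ℤ.* + den b k ∣) ℕ.≤ den b k →
  ∃₂ λ i x → M ℕ.< ∣quotient∣ b (suc i) × P ≡ x ℤ.* num b i × Q ≡ x ℤ.* + den b i
multiple-of-convergent b P (+ Q) 1≤Q Q<k small = pos-multiple-of-convergent b P 1≤Q Q<k small
multiple-of-convergent b {k} P -[1+ Q ] {M} 1≤Q Q<k small =
  let i , x , M< , P≡ , Q≡ = pos-multiple-of-convergent b (- P) {suc Q} {M} 1≤Q Q<k
        (subst (λ e → (3 ℕ.+ M) ℕ.* (suc Q ℕ.* e) ℕ.≤ den b k) ∣E∣ small)
  in i , - x , M< , negate P x (num b i) P≡ , negate -[1+ Q ] x (+ den b i) Q≡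
  where
  ∣E∣ : ∣ -[1+ Q ] ℤ.* num b k ℤ.- P ℤ.* + den b k ∣ ≡ ∣ + suc Q ℤ.* num b k ℤ.- (- P) ℤ.* + den b k ∣
  ∣E∣ = trans (cong ∣_∣ (alg (+ suc Q) (num b k) P (+ den b k)))
    (ℤₚ.∣-i∣≡∣i∣ (+ suc Q ℤ.* num b k ℤ.- (- P) ℤ.* + den b k))
    where
    alg : ∀ Q p P d → (- Q) ℤ.* p ℤ.- P ℤ.* d ≡ - (Q ℤ.* p ℤ.- (- P) ℤ.* d)
    alg = solve-∀
  negate : ∀ y x u → - y ≡ x ℤ.* u → y ≡ (- x) ℤ.* u
  negate y x u eq = trans (sym (ℤₚ.neg-involutive y))
    (trans (cong -_ eq) (ℤₚ.neg-distribˡ-* x u))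

-- Convergents in lowest terms

fromℤ-+ : ∀ i j → fromℤ (i ℤ.+ j) ≡ fromℤ i ℚ.+ fromℤ j
fromℤ-+ i j = sym (ℚₚ.toℚᵘ-injective (ℚᵘₚ.≃-trans (ℚₚ.toℚᵘ-homo-+ (fromℤ i) (fromℤ j))
  (ℚᵘ.*≡* (alg i j))))
  where
  alg : ∀ i j → (i ℤ.* + 1 ℤ.+ j ℤ.* + 1) ℤ.* + 1 ≡ (i ℤ.+ j) ℤ.* + 1
  alg = solve-∀

fromℤ-* : ∀ i j → fromℤ (i ℤ.* j) ≡ fromℤ i ℚ.* fromℤ j
fromℤ-* i j = sym (ℚₚ.toℚᵘ-injective (ℚₚ.toℚᵘ-homo-* (fromℤ i) (fromℤ j)))

fromℤ-cancel-≤ : ∀ {i j} → fromℤ i ℚ.≤ fromℤ j → i ℤ.≤ j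
fromℤ-cancel-≤ {i} {j} (*≤* i≤j) = subst₂ ℤ._≤_ (ℤₚ.*-identityʳ i) (ℤₚ.*-identityʳ j) i≤j

fraction-≡ : ∀ x n d → x ℚ.* fromℤ d ≡ fromℤ n → ↥ x ℤ.* d ≡ n ℤ.* ↧ x
fraction-≡ x@record{} n d eq with ℚₚ.toℚᵘ-homo-* x (fromℤ d)
... | h rewrite eq with h
... | ℚᵘ.*≡* e = trans (sym (ℤₚ.*-identityʳ (↥ x ℤ.* d)))
  (trans (sym e) (cong (λ z → n ℤ.* + z) (ℕₚ.*-identityʳ (↧ₙ x))))

-- A coprime pair is itself a normalised rational `mkℚ`, and normalised rationals of equal value are
-- identical.
lowest-terms-unique : ∀ x n d → 0 ℕ.< d → Coprime ∣ n ∣ d → ↥ x ℤ.* + d ≡ n ℤ.* ↧ x →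
  ↥ x ≡ n × ↧ x ≡ + d
lowest-terms-unique x@record{} n (suc d) _ coprime eq = cong ↥_ x≡ , cong ↧_ x≡
  where
  x≡ : x ≡ mkℚ n d coprime
  x≡ = ℚₚ.≃⇒≡ (*≡* eq)

∣1⇒≡1 : ∀ {d z} → + d ℤᵤ.∣ z → ∣ z ∣ ≡ 1 → d ≡ 1
∣1⇒≡1 {d} d∣z eq = ℕ∣.∣1⇒≡1 (subst (d ℕ∣.∣_) eq d∣z)

-- A common divisor divides the determinant with the next convergent, which is ±1.
num-den-coprime : ∀ b i → Coprime ∣ num b i ∣ (den b i)
num-den-coprime b i {d} (d∣n , d∣d) = ∣1⇒≡1 {z = sgn i}
  (subst (+ d ℤᵤ.∣_) (determinant b i) (ℤ∣.∣⇒∣ᵤ (ℤ∣.∣m∣n⇒∣m-n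
    (ℤ∣.∣m⇒∣m*n (num b (suc i)) (ℤ∣.∣ᵤ⇒∣ {+ d} {+ den b i} d∣d))
    (ℤ∣.∣m⇒∣m*n (+ den b (suc i)) (ℤ∣.∣ᵤ⇒∣ {+ d} {num b i} d∣n)))))
  (∣sgn∣ i)

value-fraction : ∀ b i → value b i ℚ.* fromℤ (+ den b i) ≡ fromℤ (num b i)
value-fraction b zero    = ℚₚ.*-identityʳ (fromℤ (quotient b 0))
value-fraction b (suc i) = begin
  (β ℚ.+ w) ℚ.* fromℤ (+ den b (suc i))
    ≡⟨ ℚₚ.*-distribʳ-+ (fromℤ (+ den b (suc i))) β w ⟩
  β ℚ.* fromℤ (+ den b (suc i)) ℚ.+ w ℚ.* fromℤ (+ den b (suc i))
    ≡⟨ cong₂ ℚ._+_ (sym (fromℤ-* (quotient b 0) (+ den b (suc i)))) w*den ⟩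
  fromℤ (quotient b 0 ℤ.* + den b (suc i)) ℚ.+ fromℤ (+ den (shift b) i)
    ≡⟨ fromℤ-+ (quotient b 0 ℤ.* + den b (suc i)) (+ den (shift b) i) ⟨
  fromℤ (num b (suc i)) ∎
  where
  open ≡-Reasoning
  v β w : ℚ
  instance
    v-nonZero : ℚ.NonZero (value (shift b) i)
    v-nonZero = ℚₚ.pos⇒nonZero (value (shift b) i) {{value-shift-positive b i}}
  v = value (shift b) i
  β = fromℤ (quotient b 0)
  w = 1/ v
  w*den : w ℚ.* fromℤ (+ den b (suc i)) ≡ fromℤ (+ den (shift b) i)
  w*den = begin
    w ℚ.* fromℤ (+ den b (suc i))               ≡⟨ cong (λ z → w ℚ.* fromℤ z) (num-shift b i) ⟨
    w ℚ.* fromℤ (num (shift b) i)               ≡⟨ cong (w ℚ.*_) (value-fraction (shift b) i) ⟨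
    w ℚ.* (v ℚ.* fromℤ (+ den (shift b) i))     ≡⟨ ℚₚ.*-assoc w v (fromℤ (+ den (shift b) i)) ⟨
    w ℚ.* v ℚ.* fromℤ (+ den (shift b) i)       ≡⟨ cong (ℚ._* fromℤ (+ den (shift b) i)) (ℚₚ.*-inverseˡ v) ⟩
    1ℚ ℚ.* fromℤ (+ den (shift b) i)            ≡⟨ ℚₚ.*-identityˡ (fromℤ (+ den (shift b) i)) ⟩
    fromℤ (+ den (shift b) i)                   ∎

convergent-num-den : ∀ b i → convergent b i ≡ (num b i , + den b i)
convergent-num-den b i with lowest-terms-unique (value b i) (num b i) (den b i) (den>0 b i)
  (num-den-coprime b i) (fraction-≡ (value b i) (num b i) (+ den b i) (value-fraction b i))
... | n≡ , d≡ = cong₂ _,_ n≡ d≡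

-- Leaping subscripts

-- The offset t = 0 marks the term just before block j: the leap term a_{j-1} if j ≥ 1, and c₀ if j
-- = 0.
position-in-block : ∀ ns p → ∃₂ λ j t → t ℕ.≤ ns j × p ≡ partialSum ns j ℕ.+ j ℕ.+ t
position-in-block ns zero    = 0 , 0 , z≤n , refl
position-in-block ns (suc p) with position-in-block ns p
... | j , t , t≤n , refl with suc t ℕ.≤? ns j
...   | yes t<n = j , suc t , t<n , sym (ℕₚ.+-suc _ t)
...   | no  t≮n = suc j , 0 , z≤n , trans
          (cong (λ t → suc (partialSum ns j ℕ.+ j ℕ.+ t)) (ℕₚ.≤-antisym t≤n (ℕₚ.≮⇒≥ t≮n)))
          (alg (partialSum ns j) j (ns j))
  where
  alg : ∀ s j n → suc (s ℕ.+ j ℕ.+ n) ≡ s ℕ.+ n ℕ.+ suc j ℕ.+ 0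
  alg = ℕ-Solver.solve-∀

module _ {b c a ns} (form : HasForm b c a ns) where
  open HasForm form

  block-or-leap : ∀ i → (∃ λ l → quotient b (suc i) ≡ c l) ⊎ (∃ λ j → i ≡ leapingSubscript ns j)
  block-or-leap i with position-in-block ns (suc i)
  ... | zero  , zero  , _   , ()
  ... | suc j , zero  , _   , eq = inj₂ (j , ℕₚ.suc-injective (trans eq (alg (partialSum ns (suc j)) j)))
    where
    alg : ∀ s j → s ℕ.+ suc j ℕ.+ 0 ≡ suc (s ℕ.+ j)
    alg = ℕ-Solver.solve-∀
  ... | j     , suc t , t≤n , eq = inj₁ (partialSum ns j ℕ.+ suc t ,
          trans (cong (quotient b) eq) (block-term j (suc t) (s≤s z≤n) t≤n))

term≤partialSum : ∀ f {i j} → i ℕ.< j → f i ℕ.≤ partialSum f j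
term≤partialSum f {i} {suc j} (s≤s i≤j) with ℕₚ.m≤n⇒m<n∨m≡n i≤j
... | inj₁ i<j  = ℕₚ.≤-trans (term≤partialSum f i<j) (ℕₚ.m≤m+n _ (f j))
... | inj₂ refl = ℕₚ.m≤n+m (f i) (partialSum f i)

-- `partialSum` serves here as a crude maximum: it dominates each of ∣a₀∣, ..., ∣a_{J-1}∣, while the
-- first summand dominates every block term.
large-quotient⇒late-leap : ∀ {b c a ns} → HasForm b c a ns → (bounded : Bounded c) → ∀ J {i} →
  proj₁ bounded ℕ.+ partialSum (λ j → ∣ a j ∣) J ℕ.< ∣quotient∣ b (suc i) →
  ∃ λ j → J ℕ.≤ j × i ≡ leapingSubscript ns j
large-quotient⇒late-leap {b} {c} {a} {ns} form (B , c≤B) J {i} large with block-or-leap form i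
... | inj₁ (l , eq) = ⊥-elim (ℕₚ.<⇒≱ large (ℕₚ.≤-trans
        (ℕₚ.≤-reflexive (cong ∣_∣ eq)) (ℕₚ.≤-trans (c≤B l) (ℕₚ.m≤m+n B _))))
... | inj₂ (j , refl) = j , ℕₚ.≮⇒≥ early , refl
  where
  early : j ℕ.< J → _
  early j<J = ℕₚ.<⇒≱ large (ℕₚ.≤-trans (ℕₚ.≤-reflexive (cong ∣_∣ (HasForm.leap-term form j)))
    (ℕₚ.≤-trans (term≤partialSum (λ j → ∣ a j ∣) j<J) (ℕₚ.m≤n+m _ B)))

-- Congruences

multiple⇒≈ : ∀ {n i z j} → i ≡ + n ℤ.* z ℤ.+ j → i ≈ j [mod n ]
multiple⇒≈ {n} {i} {z} {j} eq = ℤ∣.∣⇒∣ᵤ (divides z (trans (cong (ℤ._- j) eq) (alg (+ n) z j)))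
  where
  alg : ∀ n z j → n ℤ.* z ℤ.+ j ℤ.- j ≡ z ℤ.* n
  alg = solve-∀

coprime⇒Bézout : ∀ {m n} → Coprime m n → ∃₂ λ u v → u ℤ.* + m ℤ.- + 1 ≡ v ℤ.* + n
coprime⇒Bézout {m} {n} coprime with Coprimality.coprime-Bézout coprime
... | Bézout.+- u v eq = + u , + v , (begin
    + u ℤ.* + m ℤ.- + 1           ≡⟨ cong (ℤ._- + 1) (ℤₚ.pos-* u m) ⟨
    + (u ℕ.* m) ℤ.- + 1           ≡⟨ cong (λ z → + z ℤ.- + 1) eq ⟨
    + (1 ℕ.+ v ℕ.* n) ℤ.- + 1     ≡⟨ cong (ℤ._- + 1) (ℤₚ.pos-+ 1 (v ℕ.* n)) ⟩
    + 1 ℤ.+ + (v ℕ.* n) ℤ.- + 1   ≡⟨ alg (+ (v ℕ.* n)) ⟩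
    + (v ℕ.* n)                   ≡⟨ ℤₚ.pos-* v n ⟩
    + v ℤ.* + n                   ∎)
  where
  open ≡-Reasoning
  alg : ∀ z → + 1 ℤ.+ z ℤ.- + 1 ≡ z
  alg = solve-∀
... | Bézout.-+ u v eq = - + u , - + v , (begin
    - + u ℤ.* + m ℤ.- + 1         ≡⟨ alg (+ u) (+ m) ⟩
    - (+ 1 ℤ.+ + u ℤ.* + m)       ≡⟨ cong (λ z → - (+ 1 ℤ.+ z)) (ℤₚ.pos-* u m) ⟨
    - (+ 1 ℤ.+ + (u ℕ.* m))       ≡⟨ cong -_ (ℤₚ.pos-+ 1 (u ℕ.* m)) ⟨
    - + (1 ℕ.+ u ℕ.* m)           ≡⟨ cong (λ z → - + z) eq ⟩
    - + (v ℕ.* n)                 ≡⟨ cong -_ (ℤₚ.pos-* v n) ⟩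
    - (+ v ℤ.* + n)               ≡⟨ ℤₚ.neg-distribˡ-* (+ v) (+ n) ⟩
    - + v ℤ.* + n                 ∎)
  where
  open ≡-Reasoning
  alg : ∀ u m → - u ℤ.* m ℤ.- + 1 ≡ - (+ 1 ℤ.+ u ℤ.* m)
  alg = solve-∀

coprime⇒invertible : ∀ {x n} → Coprime ∣ x ∣ n → InvertibleMod n x
coprime⇒invertible {x} {n} coprime with coprime⇒Bézout coprime
... | u , v , eq = u ℤ.* s , ℤ∣.∣⇒∣ᵤ (divides v
    (trans (alg x s u) (trans (cong (λ z → u ℤ.* z ℤ.- + 1) (sign-* x)) eq)))
  where
  s : ℤ
  s = ℤ.sign x ℤ.◃ 1
  sign-* : ∀ x → (ℤ.sign x ℤ.◃ 1) ℤ.* x ≡ + ∣ x ∣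
  sign-* (+ n)    = ℤₚ.*-identityˡ (+ n)
  sign-* -[1+ n ] = cong ℤ.+[1+_] (ℕₚ.+-identityʳ n)
  alg : ∀ x s u → x ℤ.* (u ℤ.* s) ℤ.- + 1 ≡ u ℤ.* (s ℤ.* x) ℤ.- + 1
  alg = solve-∀

∣-≈ : ∀ {d x i j n} → d ℤ∣.∣ + n → d ℤ∣.∣ x → x ℤ.* i ≈ j [mod n ] → d ℤ∣.∣ j
∣-≈ {d} {x} {i} {j} {n} d∣n d∣x x*i≈j = subst (d ℤ∣.∣_) (alg (x ℤ.* i) j)
  (ℤ∣.∣m∣n⇒∣m-n (ℤ∣.∣m⇒∣m*n i d∣x) (ℤ∣.∣-trans d∣n (ℤ∣.∣ᵤ⇒∣ {+ n} {x ℤ.* i ℤ.- j} x*i≈j)))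
  where
  alg : ∀ x j → x ℤ.- (x ℤ.- j) ≡ j
  alg = solve-∀

-- By the two congruences a common divisor of x and n also divides m and r, hence their gcd with n.
multiplier-invertible : ∀ {r m n x i j} → gcd (gcd r m) (+ n) ≡ + 1 →
  x ℤ.* i ≈ m [mod n ] → x ℤ.* j ≈ - r [mod n ] → InvertibleMod n x
multiplier-invertible {r} {m} {n} {x} {i} {j} gcd≡1 xi≈m xj≈-r = coprime⇒invertible {x} coprime
  where
  coprime : Coprime ∣ x ∣ n
  coprime {d} (d∣x , d∣n) = ∣1⇒≡1 {z = gcd (gcd r m) (+ n)}
    (gcd-greatest {gcd r m} {+ n} {+ d} (gcd-greatest {r} {m} {+ d} d∣r d∣m) d∣n) (cong ∣_∣ gcd≡1)
    where
    d∣n′ : + d ℤ∣.∣ + n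
    d∣n′ = ℤ∣.∣ᵤ⇒∣ {+ d} {+ n} d∣n
    d∣x′ : + d ℤ∣.∣ x
    d∣x′ = ℤ∣.∣ᵤ⇒∣ {+ d} {x} d∣x
    d∣m : + d ℤᵤ.∣ m
    d∣m = ℤ∣.∣⇒∣ᵤ (∣-≈ {x = x} {i} {m} d∣n′ d∣x′ xi≈m)
    d∣r : + d ℤᵤ.∣ r
    d∣r = subst (+ d ℤᵤ.∣_) (ℤₚ.neg-involutive r)
      (ℤ∣.∣⇒∣ᵤ (ℤ∣.∣m⇒∣-m (∣-≈ {x = x} {j} { - r} d∣n′ d∣x′ xj≈-r)))

-- A zero remainder means that n divides g, hence 1 by g h ≈ 1, against n ≥ 2.
invertible⇒%≢0 : ∀ {n g} .{{_ : ℕ.NonZero n}} → 2 ℕ.≤ n → InvertibleMod n g → 1 ℕ.≤ g ℤ-DivMod.%ℕ n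
invertible⇒%≢0 {n} {g} 2≤n (h , gh≈1) with g ℤ-DivMod.%ℕ n in eq
... | suc _ = s≤s z≤n
... | zero  = ⊥-elim (ℕₚ.<⇒≢ 2≤n (sym (∣1⇒≡1 {z = + 1}
  (ℤ∣.∣⇒∣ᵤ (∣-≈ {x = g} {h} {+ 1} ℤ∣.∣-refl (divides (g ℤ-DivMod./ℕ n) g≡) gh≈1)) refl)))
  where
  g≡ : g ≡ (g ℤ-DivMod./ℕ n) ℤ.* + n
  g≡ = trans (ℤ-DivMod.a≡a%ℕn+[a/ℕn]*n g n)
    (trans (cong (λ z → + z ℤ.+ (g ℤ-DivMod./ℕ n) ℤ.* + n) eq) (ℤₚ.+-identityˡ _))

-- Applied to both coordinates of a leaper, the witnesses are the integers z and q of P = nz + m and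
-- Q = nq - r.
%-≈ : ∀ {n} .{{_ : ℕ.NonZero n}} g {i j} → g ℤ.* i ≈ j [mod n ] →
  ∃ λ z → + (g ℤ-DivMod.%ℕ n) ℤ.* i ≡ + n ℤ.* z ℤ.+ j
%-≈ {n} g {i} {j} gi≈j with ℤ∣.∣ᵤ⇒∣ {+ n} {g ℤ.* i ℤ.- j} gi≈j
... | divides u eq = u ℤ.- g/n ℤ.* i , (begin
  + g%n ℤ.* i                                              ≡⟨ alg (+ g%n) g/n (+ n) i j ⟩
  ((+ g%n ℤ.+ g/n ℤ.* + n) ℤ.* i ℤ.- j) ℤ.+ j ℤ.- g/n ℤ.* + n ℤ.* i
    ≡⟨ cong (λ g → (g ℤ.* i ℤ.- j) ℤ.+ j ℤ.- g/n ℤ.* + n ℤ.* i) (ℤ-DivMod.a≡a%ℕn+[a/ℕn]*n g n) ⟨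
  (g ℤ.* i ℤ.- j) ℤ.+ j ℤ.- g/n ℤ.* + n ℤ.* i              ≡⟨ cong (λ w → w ℤ.+ j ℤ.- g/n ℤ.* + n ℤ.* i) eq ⟩
  u ℤ.* + n ℤ.+ j ℤ.- g/n ℤ.* + n ℤ.* i                    ≡⟨ alg′ u g/n (+ n) i j ⟩
  + n ℤ.* (u ℤ.- g/n ℤ.* i) ℤ.+ j                          ∎)
  where
  open ≡-Reasoning
  g%n : ℕ
  g%n = g ℤ-DivMod.%ℕ n
  g/n : ℤ
  g/n = g ℤ-DivMod./ℕ n
  alg : ∀ a c n i j → a ℤ.* i ≡ ((a ℤ.+ c ℤ.* n) ℤ.* i ℤ.- j) ℤ.+ j ℤ.- c ℤ.* n ℤ.* i
  alg = solve-∀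
  alg′ : ∀ u c n i j → u ℤ.* n ℤ.+ j ℤ.- c ℤ.* n ℤ.* i ≡ n ℤ.* (u ℤ.- c ℤ.* i) ℤ.+ j
  alg′ = solve-∀

-- Approximation of the real problem

1/n*n≡1 : ∀ n .{{_ : ℕ.NonZero n}} → ((+ 1) / n) ℚ.* fromℤ (+ n) ≡ 1ℚ
1/n*n≡1 (suc n) = ℚₚ.toℚᵘ-injective (ℚᵘₚ.≃-trans (ℚₚ.toℚᵘ-homo-* ((+ 1) / suc n) (fromℤ (+ suc n)))
  (ℚᵘₚ.≃-trans (ℚᵘₚ.*-congʳ (ℚₚ.toℚᵘ-fromℚᵘ (ℚᵘ.mkℚᵘ (+ 1) n))) (ℚᵘ.*≡* (alg (+ suc n)))))
  where
  alg : ∀ n → (+ 1 ℤ.* n) ℤ.* + 1 ≡ + 1 ℤ.* (n ℤ.* + 1)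
  alg = solve-∀

0<½* : ∀ {ε} → 0ℚ ℚ.< ε → 0ℚ ℚ.< ½ ℚ.* ε
0<½* {ε} 0<ε = subst (ℚ._< ½ ℚ.* ε) (ℚₚ.*-zeroʳ ½) (ℚₚ.*-monoʳ-<-pos ½ 0<ε)

½+½ : ∀ ε → ½ ℚ.* ε ℚ.+ ½ ℚ.* ε ≡ ε
½+½ ε = trans (sym (ℚₚ.*-distribʳ-+ ε ½ ½)) (ℚₚ.*-identityˡ ε)

-- The product is the numerator of ε, a positive integer. The denominator of ε thus acts as an
-- integer upper bound for 1/ε.
1≤ε*↧ε : ∀ {ε} → 0ℚ ℚ.< ε → 1ℚ ℚ.≤ ε ℚ.* fromℤ (↧ ε)
1≤ε*↧ε {ε@(mkℚ ℤ.+[1+ a ] d _)} _ = ℚₚ.toℚᵘ-cancel-≤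
  (ℚᵘₚ.≤-respʳ-≃ (ℚᵘₚ.≃-sym (ℚₚ.toℚᵘ-homo-* ε (fromℤ (↧ ε))))
    (ℚᵘ.*≤* (subst₂ ℤ._≤_ (alg (+ suc d)) (alg′ (ℤ.+[1+ a ]) (+ suc d))
      (ℤₚ.*-monoʳ-≤-nonNeg (+ suc d) (ℤ.+≤+ {1} {suc a} (s≤s z≤n))))))
  where
  alg : ∀ d → + 1 ℤ.* d ≡ + 1 ℤ.* (d ℤ.* + 1)
  alg = solve-∀
  alg′ : ∀ a d → a ℤ.* d ≡ (a ℤ.* d) ℤ.* + 1
  alg′ = solve-∀
1≤ε*↧ε {mkℚ (+ zero) d _} (*<* (ℤ.+<+ ()))
1≤ε*↧ε {mkℚ -[1+ a ] d _} (*<* ())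

∣fromℤ∣ : ∀ i → ℚ.∣ fromℤ i ∣ ≡ fromℤ (+ ∣ i ∣)
∣fromℤ∣ i = refl

divide : ∀ L .{{_ : ℚ.Positive L}} {ε} → 0ℚ ℚ.< ε → ∃ λ δ → 0ℚ ℚ.< δ × L ℚ.* δ ≡ ε
divide L {ε} 0<ε = 1/ L ℚ.* ε ,
  subst (ℚ._< 1/ L ℚ.* ε) (ℚₚ.*-zeroʳ (1/ L)) (ℚₚ.*-monoʳ-<-pos (1/ L) {{ℚₚ.1/pos⇒pos L}} 0<ε) ,
  trans (sym (ℚₚ.*-assoc L (1/ L) ε)) (trans (cong (ℚ._* ε) (ℚₚ.*-inverseʳ L)) (ℚₚ.*-identityˡ ε))
  where
  instance
    L-nonZero : ℚ.NonZero L
    L-nonZero = ℚₚ.pos⇒nonZero L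

-- Dividing ε by 1 + K rather than K also covers K = 0, as for the Lipschitz constant at q = 0.
shrink : ∀ K .{{_ : ℚ.NonNegative K}} {ε} → 0ℚ ℚ.< ε →
  ∃ λ δ → 0ℚ ℚ.< δ × (∀ x → x ℚ.≤ δ → K ℚ.* x ℚ.≤ ε)
shrink K {ε} 0<ε = δ , proj₁ (proj₂ δ-spec) , λ x x≤δ → begin
  K ℚ.* x                   ≤⟨ ℚₚ.*-monoˡ-≤-nonNeg K x≤δ ⟩
  K ℚ.* δ                   ≡⟨ ℚₚ.+-identityˡ (K ℚ.* δ) ⟨
  0ℚ ℚ.+ K ℚ.* δ            ≤⟨ ℚₚ.+-monoˡ-≤ (K ℚ.* δ) (ℚₚ.<⇒≤ (proj₁ (proj₂ δ-spec))) ⟩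
  δ ℚ.+ K ℚ.* δ             ≡⟨ cong (ℚ._+ K ℚ.* δ) (ℚₚ.*-identityˡ δ) ⟨
  1ℚ ℚ.* δ ℚ.+ K ℚ.* δ      ≡⟨ ℚₚ.*-distribʳ-+ δ 1ℚ K ⟨
  (1ℚ ℚ.+ K) ℚ.* δ          ≡⟨ proj₂ (proj₂ δ-spec) ⟩
  ε                         ∎
  where
  open ℚₚ.≤-Reasoning
  δ-spec : ∃ λ δ → 0ℚ ℚ.< δ × (1ℚ ℚ.+ K) ℚ.* δ ≡ ε
  δ-spec = divide (1ℚ ℚ.+ K) {{ℚₚ.pos+nonNeg⇒pos 1ℚ K}} 0<ε
  δ : ℚ
  δ = proj₁ δ-spec

0≤‖‖ : ∀ p → 0ℚ ℚ.≤ ‖ p ‖ℚ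
0≤‖‖ p with ‖‖-attained p
... | z , eq = subst (0ℚ ℚ.≤_) (sym eq) (ℚₚ.0≤∣p∣ (p ℚ.- fromℤ z))

‖‖-triangle : ∀ p q → ‖ p ‖ℚ ℚ.≤ ℚ.∣ p ℚ.- q ∣ ℚ.+ ‖ q ‖ℚ
‖‖-triangle p q with ‖‖-attained q
... | z , eq = subst (λ w → ‖ p ‖ℚ ℚ.≤ ℚ.∣ p ℚ.- q ∣ ℚ.+ w) (sym eq)
  (ℚₚ.≤-trans (‖p‖≤∣p-k∣ p z) (triangle p q (fromℤ z)))

module Approximation (r m : ℤ) (n : ℕ) .{{_ : ℕ.NonZero n}} (q : ℤ) where

  -- qx − φ with φ = (rx + m)/n, written as the terms of the approximating sequences compute.
  offset : ℚ → ℚ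
  offset x = fromℤ q ℚ.* x ℚ.+ (ℚ.- 1ℚ) ℚ.* (((+ 1) / n) ℚ.* (fromℤ r ℚ.* x ℚ.+ fromℤ m))

  slope : ℚ
  slope = fromℤ q ℚ.+ (ℚ.- 1ℚ) ℚ.* (((+ 1) / n) ℚ.* fromℤ r)

  weighted : ℚ → ℚ
  weighted x = fromℤ (+ ∣ q ∣) ℚ.* ‖ offset x ‖ℚ

  lipschitz : ℚ
  lipschitz = fromℤ (+ ∣ q ∣) ℚ.* ℚ.∣ slope ∣

  0≤weighted : ∀ x → 0ℚ ℚ.≤ weighted x
  0≤weighted x = subst (ℚ._≤ weighted x) (ℚₚ.*-zeroʳ (fromℤ (+ ∣ q ∣)))
    (ℚₚ.*-monoˡ-≤-nonNeg (fromℤ (+ ∣ q ∣)) (0≤‖‖ (offset x)))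

  lipschitz-nonNeg : ℚ.NonNegative lipschitz
  lipschitz-nonNeg = ℚ.nonNegative (subst (ℚ._≤ lipschitz) (ℚₚ.*-zeroʳ (fromℤ (+ ∣ q ∣)))
    (ℚₚ.*-monoˡ-≤-nonNeg (fromℤ (+ ∣ q ∣)) (ℚₚ.0≤∣p∣ slope)))

  offset-difference : ∀ x y → ℚ.∣ offset x ℚ.- offset y ∣ ≡ ℚ.∣ slope ∣ ℚ.* ℚ.∣ x ℚ.- y ∣
  offset-difference x y = trans (cong ℚ.∣_∣ (alg
    (fromℤ q) (ℚ.- 1ℚ) ((+ 1) / n) (fromℤ r) (fromℤ m) x y)) (ℚₚ.∣p*q∣≡∣p∣*∣q∣ slope (x ℚ.- y))
    where
    alg : ∀ q u ι r m x y → (q ℚ.* x ℚ.+ u ℚ.* (ι ℚ.* (r ℚ.* x ℚ.+ m))) ℚ.- (q ℚ.* y ℚ.+ u ℚ.* (ι ℚ.* (r ℚ.* y ℚ.+ m)))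
        ≡ (q ℚ.+ u ℚ.* (ι ℚ.* r)) ℚ.* (x ℚ.- y)
    alg = solve 7
      (λ q u ι r m x y → (q :* x :+ u :* (ι :* (r :* x :+ m))) :- (q :* y :+ u :* (ι :* (r :* y :+ m)))
                      := (q :+ u :* (ι :* r)) :* (x :- y)) refl
      where open ℚ-Solver.+-*-Solver

  weighted-lipschitz : ∀ x y → weighted x ℚ.≤ lipschitz ℚ.* ℚ.∣ x ℚ.- y ∣ ℚ.+ weighted y
  weighted-lipschitz x y = begin
    A ℚ.* ‖ offset x ‖ℚ                                     ≤⟨ ℚₚ.*-monoˡ-≤-nonNeg A (‖‖-triangle (offset x) (offset y)) ⟩
    A ℚ.* (ℚ.∣ offset x ℚ.- offset y ∣ ℚ.+ ‖ offset y ‖ℚ)   ≡⟨ cong (λ z → A ℚ.* (z ℚ.+ ‖ offset y ‖ℚ)) (offset-difference x y) ⟩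
    A ℚ.* (ℚ.∣ slope ∣ ℚ.* ℚ.∣ x ℚ.- y ∣ ℚ.+ ‖ offset y ‖ℚ) ≡⟨ ℚₚ.*-distribˡ-+ A (ℚ.∣ slope ∣ ℚ.* ℚ.∣ x ℚ.- y ∣) ‖ offset y ‖ℚ ⟩
    A ℚ.* (ℚ.∣ slope ∣ ℚ.* ℚ.∣ x ℚ.- y ∣) ℚ.+ weighted y    ≡⟨ cong (ℚ._+ weighted y) (ℚₚ.*-assoc A ℚ.∣ slope ∣ ℚ.∣ x ℚ.- y ∣) ⟨
    lipschitz ℚ.* ℚ.∣ x ℚ.- y ∣ ℚ.+ weighted y              ∎
    where
    open ℚₚ.≤-Reasoning
    A : ℚ
    A = fromℤ (+ ∣ q ∣)

  numerator : SimpleCF → ℕ → ℤ → ℤ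
  numerator b k z = (+ n ℤ.* q ℤ.- r) ℤ.* num b k ℤ.- (+ n ℤ.* z ℤ.+ m) ℤ.* + den b k

  scale : SimpleCF → ℕ → ℚ
  scale b k = fromℤ (+ (n ℕ.* den b k))

  -- Clearing the denominators n of φ and qₖ of the convergent turns the distance to z into the
  -- integer Qpₖ - Pqₖ.
  offset-numerator : ∀ b k z →
    (offset (value b k) ℚ.- fromℤ z) ℚ.* scale b k ≡ fromℤ (numerator b k z)
  offset-numerator b k z = begin
    (offset v ℚ.- Z) ℚ.* scale b k
      ≡⟨ cong ((offset v ℚ.- Z) ℚ.*_) (trans (cong fromℤ (ℤₚ.pos-* n (den b k))) (fromℤ-* (+ n) (+ den b k))) ⟩
    (offset v ℚ.- Z) ℚ.* (N ℚ.* D)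
      ≡⟨ alg (fromℤ q) R M N Z v D ((+ 1) / n) ⟩
    (N ℚ.* fromℤ q) ℚ.* (v ℚ.* D) ℚ.- (((+ 1) / n) ℚ.* N) ℚ.* (R ℚ.* (v ℚ.* D) ℚ.+ M ℚ.* D) ℚ.- (N ℚ.* Z) ℚ.* D
      ≡⟨ cong₂ (λ x y → (N ℚ.* fromℤ q) ℚ.* x ℚ.- y ℚ.* (R ℚ.* x ℚ.+ M ℚ.* D) ℚ.- (N ℚ.* Z) ℚ.* D)
           (value-fraction b k) (1/n*n≡1 n) ⟩
    (N ℚ.* fromℤ q) ℚ.* p ℚ.- 1ℚ ℚ.* (R ℚ.* p ℚ.+ M ℚ.* D) ℚ.- (N ℚ.* Z) ℚ.* D
      ≡⟨ alg′ (fromℤ q) R M N Z p D ⟩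
    (N ℚ.* fromℤ q ℚ.- R) ℚ.* p ℚ.- (N ℚ.* Z ℚ.+ M) ℚ.* D
      ≡⟨ cong₂ (λ x y → (x ℚ.- R) ℚ.* p ℚ.- (y ℚ.+ M) ℚ.* D) (fromℤ-* (+ n) q) (fromℤ-* (+ n) z) ⟨
    (fromℤ (+ n ℤ.* q) ℚ.- R) ℚ.* p ℚ.- (fromℤ (+ n ℤ.* z) ℚ.+ M) ℚ.* D
      ≡⟨ cong₂ (λ x y → x ℚ.* p ℚ.- y ℚ.* D) (fromℤ-- (+ n ℤ.* q) r) (fromℤ-+ (+ n ℤ.* z) m) ⟨
    fromℤ (+ n ℤ.* q ℤ.- r) ℚ.* p ℚ.- fromℤ (+ n ℤ.* z ℤ.+ m) ℚ.* D
      ≡⟨ cong₂ ℚ._-_ (fromℤ-* (+ n ℤ.* q ℤ.- r) (num b k)) (fromℤ-* (+ n ℤ.* z ℤ.+ m) (+ den b k)) ⟨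
    fromℤ ((+ n ℤ.* q ℤ.- r) ℤ.* num b k) ℚ.- fromℤ ((+ n ℤ.* z ℤ.+ m) ℤ.* + den b k)
      ≡⟨ fromℤ-- ((+ n ℤ.* q ℤ.- r) ℤ.* num b k) ((+ n ℤ.* z ℤ.+ m) ℤ.* + den b k) ⟨
    fromℤ (numerator b k z) ∎
    where
    open ≡-Reasoning
    alg : ∀ q r m n z v d ι → ((q ℚ.* v ℚ.+ (ℚ.- 1ℚ) ℚ.* (ι ℚ.* (r ℚ.* v ℚ.+ m))) ℚ.- z) ℚ.* (n ℚ.* d)
        ≡ (n ℚ.* q) ℚ.* (v ℚ.* d) ℚ.- (ι ℚ.* n) ℚ.* (r ℚ.* (v ℚ.* d) ℚ.+ m ℚ.* d) ℚ.- (n ℚ.* z) ℚ.* d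
    alg = solve 8 (λ q r m n z v d ι →
      ((q :* v :+ con (ℚ.- 1ℚ) :* (ι :* (r :* v :+ m))) :- z) :* (n :* d)
      := (n :* q) :* (v :* d) :- (ι :* n) :* (r :* (v :* d) :+ m :* d) :- (n :* z) :* d) refl
      where open ℚ-Solver.+-*-Solver
    alg′ : ∀ q r m n z p d → (n ℚ.* q) ℚ.* p ℚ.- 1ℚ ℚ.* (r ℚ.* p ℚ.+ m ℚ.* d) ℚ.- (n ℚ.* z) ℚ.* d
         ≡ (n ℚ.* q ℚ.- r) ℚ.* p ℚ.- (n ℚ.* z ℚ.+ m) ℚ.* d
    alg′ = solve 7 (λ q r m n z p d →
      (n :* q) :* p :- con 1ℚ :* (r :* p :+ m :* d) :- (n :* z) :* d
      := (n :* q :- r) :* p :- (n :* z :+ m) :* d) refl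
      where open ℚ-Solver.+-*-Solver
    v p D N R M Z : ℚ
    v = value b k
    p = fromℤ (num b k)
    D = fromℤ (+ den b k)
    N = fromℤ (+ n)
    R = fromℤ r
    M = fromℤ m
    Z = fromℤ z
    fromℤ-- : ∀ i j → fromℤ (i ℤ.- j) ≡ fromℤ i ℚ.- fromℤ j
    fromℤ-- i j = trans (fromℤ-+ i (- j)) (cong (fromℤ i ℚ.+_) (fromℤ-neg j))

  weighted-numerator : ∀ b k z →
    fromℤ (+ ∣ q ∣) ℚ.* ℚ.∣ offset (value b k) ℚ.- fromℤ z ∣ ℚ.* scale b k
    ≡ fromℤ (+ (∣ q ∣ ℕ.* ∣ numerator b k z ∣))
  weighted-numerator b k z = begin
    A ℚ.* ℚ.∣ d ∣ ℚ.* scale b k                    ≡⟨ ℚₚ.*-assoc A ℚ.∣ d ∣ (scale b k) ⟩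
    A ℚ.* (ℚ.∣ d ∣ ℚ.* ℚ.∣ scale b k ∣)            ≡⟨ cong (A ℚ.*_) (ℚₚ.∣p*q∣≡∣p∣*∣q∣ d (scale b k)) ⟨
    A ℚ.* ℚ.∣ d ℚ.* scale b k ∣                    ≡⟨ cong (A ℚ.*_) (trans (cong ℚ.∣_∣ (offset-numerator b k z)) (∣fromℤ∣ (numerator b k z))) ⟩
    A ℚ.* fromℤ (+ ∣ numerator b k z ∣)            ≡⟨ fromℤ-* (+ ∣ q ∣) (+ ∣ numerator b k z ∣) ⟨
    fromℤ (+ ∣ q ∣ ℤ.* + ∣ numerator b k z ∣)      ≡⟨ cong fromℤ (ℤₚ.pos-* ∣ q ∣ ∣ numerator b k z ∣) ⟨
    fromℤ (+ (∣ q ∣ ℕ.* ∣ numerator b k z ∣))      ∎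
    where
    open ≡-Reasoning
    A d : ℚ
    A = fromℤ (+ ∣ q ∣)
    d = offset (value b k) ℚ.- fromℤ z

  small-weighted⇒small-numerator : ∀ b k T .{{_ : ℕ.NonZero T}} → weighted (value b k) ℚ.≤ (+ 1) / T →
    ∃ λ z → T ℕ.* (∣ q ∣ ℕ.* ∣ numerator b k z ∣) ℕ.≤ n ℕ.* den b k
  small-weighted⇒small-numerator b k T small with ‖‖-attained (offset (value b k))
  ... | z , eq = z , ℤₚ.drop‿+≤+ (fromℤ-cancel-≤ (begin
    fromℤ (+ (T ℕ.* (∣ q ∣ ℕ.* ∣ numerator b k z ∣)))
      ≡⟨ trans (cong fromℤ (ℤₚ.pos-* T (∣ q ∣ ℕ.* ∣ numerator b k z ∣))) (fromℤ-* (+ T) (+ (∣ q ∣ ℕ.* ∣ numerator b k z ∣))) ⟩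
    fromℤ (+ T) ℚ.* fromℤ (+ (∣ q ∣ ℕ.* ∣ numerator b k z ∣))
      ≡⟨ cong (fromℤ (+ T) ℚ.*_) (weighted-numerator b k z) ⟨
    fromℤ (+ T) ℚ.* (fromℤ (+ ∣ q ∣) ℚ.* ℚ.∣ offset (value b k) ℚ.- fromℤ z ∣ ℚ.* scale b k)
      ≡⟨ cong (λ w → fromℤ (+ T) ℚ.* (fromℤ (+ ∣ q ∣) ℚ.* w ℚ.* scale b k)) eq ⟨
    fromℤ (+ T) ℚ.* (weighted (value b k) ℚ.* scale b k)
      ≤⟨ ℚₚ.*-monoˡ-≤-nonNeg (fromℤ (+ T)) (ℚₚ.*-monoʳ-≤-nonNeg (scale b k) small) ⟩
    fromℤ (+ T) ℚ.* (((+ 1) / T) ℚ.* scale b k)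
      ≡⟨ ℚₚ.*-assoc (fromℤ (+ T)) ((+ 1) / T) (scale b k) ⟨
    fromℤ (+ T) ℚ.* ((+ 1) / T) ℚ.* scale b k
      ≡⟨ cong (ℚ._* scale b k) (trans (ℚₚ.*-comm (fromℤ (+ T)) ((+ 1) / T)) (1/n*n≡1 T)) ⟩
    1ℚ ℚ.* scale b k
      ≡⟨ ℚₚ.*-identityˡ (scale b k) ⟩
    scale b k ∎))
    where open ℚₚ.≤-Reasoning

  -- The integer z need not be nearest: the distance to it bounds `‖_‖ℚ` from above.
  small-numerator⇒small-weighted : ∀ b k z {ε} → 0ℚ ℚ.< ε →
    ↧ₙ ε ℕ.* (∣ q ∣ ℕ.* ∣ numerator b k z ∣) ℕ.≤ n ℕ.* den b k → weighted (value b k) ℚ.≤ ε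
  small-numerator⇒small-weighted b k z {ε} 0<ε small = ℚₚ.*-cancelʳ-≤-pos (scale b k) {{scale-positive}} (begin
    weighted (value b k) ℚ.* scale b k
      ≤⟨ ℚₚ.*-monoʳ-≤-nonNeg (scale b k) (ℚₚ.*-monoˡ-≤-nonNeg (fromℤ (+ ∣ q ∣)) (‖p‖≤∣p-k∣ (offset (value b k)) z)) ⟩
    fromℤ (+ ∣ q ∣) ℚ.* ℚ.∣ offset (value b k) ℚ.- fromℤ z ∣ ℚ.* scale b k
      ≡⟨ weighted-numerator b k z ⟩
    fromℤ (+ S)
      ≡⟨ ℚₚ.*-identityˡ (fromℤ (+ S)) ⟨
    1ℚ ℚ.* fromℤ (+ S)
      ≤⟨ ℚₚ.*-monoʳ-≤-nonNeg (fromℤ (+ S)) (1≤ε*↧ε 0<ε) ⟩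
    ε ℚ.* fromℤ (↧ ε) ℚ.* fromℤ (+ S)
      ≡⟨ ℚₚ.*-assoc ε (fromℤ (↧ ε)) (fromℤ (+ S)) ⟩
    ε ℚ.* (fromℤ (↧ ε) ℚ.* fromℤ (+ S))
      ≡⟨ cong (ε ℚ.*_) (trans (cong fromℤ (ℤₚ.pos-* (↧ₙ ε) S)) (fromℤ-* (↧ ε) (+ S))) ⟨
    ε ℚ.* fromℤ (+ (↧ₙ ε ℕ.* S))
      ≤⟨ ℚₚ.*-monoˡ-≤-nonNeg ε {{ℚ.nonNegative (ℚₚ.<⇒≤ 0<ε)}} (fromℤ-mono (ℤ.+≤+ small)) ⟩
    ε ℚ.* scale b k ∎)
    where
    open ℚₚ.≤-Reasoning
    S : ℕ
    S = ∣ q ∣ ℕ.* ∣ numerator b k z ∣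
    scale-positive : ℚ.Positive (scale b k)
    scale-positive = fromℤ-positive {+ (n ℕ.* den b k)}
      (ℤ.positive (ℤ.+<+ (ℕₚ.*-mono-≤ (ℕ.>-nonZero⁻¹ n) (den>0 b k))))

-- The slack δ contained in a strict inequality of reals pays for replacing θ by a convergent. The
-- sum with 0ℚ is what `fromℚ 0ℚ +ᴿ fromℚ ε` computes to.
≤-+-shift : ∀ {w x y δ ε} → w ℚ.≤ x ℚ.+ y → x ℚ.≤ δ → y ℚ.+ δ ℚ.≤ 0ℚ ℚ.+ ε → w ℚ.≤ ε
≤-+-shift {w} {x} {y} {δ} {ε} w≤x+y x≤δ y+δ≤ε = begin
  w             ≤⟨ w≤x+y ⟩
  x ℚ.+ y       ≤⟨ ℚₚ.+-monoˡ-≤ y x≤δ ⟩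
  δ ℚ.+ y       ≡⟨ ℚₚ.+-comm δ y ⟩
  y ℚ.+ δ       ≤⟨ y+δ≤ε ⟩
  0ℚ ℚ.+ ε      ≡⟨ ℚₚ.+-identityˡ ε ⟩
  ε             ∎
  where open ℚₚ.≤-Reasoning

-- Budget of ε: a quarter for the Lipschitz error, half for the value at the convergent, a quarter
-- as the witness of strictness.
¼+½+¼ : ∀ {w x y} ε → w ℚ.≤ x ℚ.+ y → x ℚ.≤ ½ ℚ.* (½ ℚ.* ε) → y ℚ.≤ ½ ℚ.* ε →
  w ℚ.+ ½ ℚ.* (½ ℚ.* ε) ℚ.≤ 0ℚ ℚ.+ ε
¼+½+¼ {w} {x} {y} ε w≤x+y x≤δ y≤½ε = begin
  w ℚ.+ δ                         ≤⟨ ℚₚ.+-monoˡ-≤ δ w≤x+y ⟩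
  x ℚ.+ y ℚ.+ δ                   ≤⟨ ℚₚ.+-monoˡ-≤ δ (ℚₚ.+-mono-≤ x≤δ y≤½ε) ⟩
  δ ℚ.+ ½ ℚ.* ε ℚ.+ δ             ≡⟨ alg δ (½ ℚ.* ε) ⟩
  δ ℚ.+ δ ℚ.+ ½ ℚ.* ε             ≡⟨ cong (ℚ._+ ½ ℚ.* ε) (½+½ (½ ℚ.* ε)) ⟩
  ½ ℚ.* ε ℚ.+ ½ ℚ.* ε             ≡⟨ ½+½ ε ⟩
  ε                               ≡⟨ ℚₚ.+-identityˡ ε ⟨
  0ℚ ℚ.+ ε                        ∎
  where
  open ℚₚ.≤-Reasoning
  δ : ℚ
  δ = ½ ℚ.* (½ ℚ.* ε)
  alg : ∀ d e → d ℚ.+ e ℚ.+ d ≡ d ℚ.+ d ℚ.+ e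
  alg = solve 2 (λ d e → d :+ e :+ d := d :+ d :+ e) refl
    where open ℚ-Solver.+-*-Solver

-ε+ε≤ : ∀ ε {w} → 0ℚ ℚ.≤ w → 0ℚ ℚ.+ (ℚ.- 1ℚ) ℚ.* ε ℚ.+ ε ℚ.≤ w
-ε+ε≤ ε {w} = subst (ℚ._≤ w) (alg ε)
  where
  alg : ∀ e → 0ℚ ≡ 0ℚ ℚ.+ (ℚ.- 1ℚ) ℚ.* e ℚ.+ e
  alg = solve 1 (λ e → con 0ℚ := con 0ℚ :+ con (ℚ.- 1ℚ) :* e :+ e) refl
    where open ℚ-Solver.+-*-Solver

-- Transfer between θ and its far convergents

module _ {θ b} (cf : θ HasCF b) where

  value-close : ∀ {ε} → 0ℚ ℚ.< ε → ∀ k₀ → ∃ λ k → k₀ ℕ.≤ k ×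
    ∃ λ N → ∀ i → N ℕ.≤ i → ℚ.∣ value b k ℚ.- approx θ i ∣ ℚ.≤ ε
  value-close {ε} 0<ε k₀ with cf ε 0<ε
  ... | K , close with close (K ℕ.⊔ k₀) (ℕₚ.m≤m⊔n K k₀)
  ... | δ , 0<δ , N , bound = K ℕ.⊔ k₀ , ℕₚ.m≤n⊔m K k₀ , N , λ i N≤i → begin
    ℚ.∣ v ℚ.- approx θ i ∣
      ≡⟨ cong ℚ.∣_∣ (solve 2 (λ v x → v :- x := v :+ con (ℚ.- 1ℚ) :* x) refl v (approx θ i)) ⟩
    ℚ.∣ v ℚ.+ (ℚ.- 1ℚ) ℚ.* approx θ i ∣
      ≡⟨ ℚₚ.+-identityʳ _ ⟨
    ℚ.∣ v ℚ.+ (ℚ.- 1ℚ) ℚ.* approx θ i ∣ ℚ.+ 0ℚ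
      ≤⟨ ℚₚ.+-monoʳ-≤ ℚ.∣ v ℚ.+ (ℚ.- 1ℚ) ℚ.* approx θ i ∣ (ℚₚ.<⇒≤ 0<δ) ⟩
    ℚ.∣ v ℚ.+ (ℚ.- 1ℚ) ℚ.* approx θ i ∣ ℚ.+ δ
      ≤⟨ bound i N≤i ⟩
    ε ∎
    where
    open ℚₚ.≤-Reasoning
    open ℚ-Solver.+-*-Solver
    v : ℚ
    v = value b (K ℕ.⊔ k₀)

  value-close-scaled : ∀ K .{{_ : ℚ.NonNegative K}} {ε} → 0ℚ ℚ.< ε → ∀ k₀ → ∃ λ k → k₀ ℕ.≤ k ×
    ∃ λ N → ∀ i → N ℕ.≤ i → K ℚ.* ℚ.∣ value b k ℚ.- approx θ i ∣ ℚ.≤ ε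
  value-close-scaled K {ε} 0<ε k₀ =
    let δ , 0<δ , small = shrink K 0<ε
        k , k₀≤k , N , close = value-close 0<δ k₀
    in k , k₀≤k , N , λ i N≤i → small ℚ.∣ value b k ℚ.- approx θ i ∣ (close i N≤i)

  module _ (r m : ℤ) (n : ℕ) .{{_ : ℕ.NonZero n}} where
    open Approximation r m n

    term : ℤ → ℝ
    term q = fromℤ (+ ∣ q ∣) · ‖ fromℤ q · θ -ᴿ ((+ 1) / n) · (fromℤ r · θ +ᴿ fromℚ (fromℤ m)) ‖

    term<⇒weighted≤ : ∀ q {ε} → term q <ᴿ fromℚ 0ℚ +ᴿ fromℚ ε →
      ∀ k₀ → ∃ λ k → k₀ ℕ.≤ k × weighted q (value b k) ℚ.≤ ε
    term<⇒weighted≤ q {ε} (δ , 0<δ , N , bound) k₀ =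
      let k , k₀≤k , N′ , close = value-close-scaled (lipschitz q) {{lipschitz-nonNeg q}} 0<δ k₀
          i = N ℕ.⊔ N′
      in k , k₀≤k , ≤-+-shift (weighted-lipschitz q (value b k) (approx θ i))
           (close i (ℕₚ.m≤n⊔m N N′)) (bound i (ℕₚ.m≤m⊔n N N′))

    weighted≤⇒term< : ∀ q {ε} → 0ℚ ℚ.< ε → ∀ k₀ →
      (∀ k → k₀ ℕ.≤ k → weighted q (value b k) ℚ.≤ ½ ℚ.* ε) → term q <ᴿ fromℚ 0ℚ +ᴿ fromℚ ε
    weighted≤⇒term< q {ε} 0<ε k₀ bound =
      let k , k₀≤k , N , close = value-close-scaled (lipschitz q) {{lipschitz-nonNeg q}} (0<½* (0<½* 0<ε)) k₀
      in ½ ℚ.* (½ ℚ.* ε) , 0<½* (0<½* 0<ε) , N , λ i N≤i → ¼+½+¼ ε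
           (weighted-lipschitz q (approx θ i) (value b k))
           (subst (λ d → lipschitz q ℚ.* d ℚ.≤ ½ ℚ.* (½ ℚ.* ε)) (∣p-q∣≡∣q-p∣ (value b k) (approx θ i)) (close i N≤i))
           (bound k k₀≤k)

    -ε<term : ∀ q {ε} → 0ℚ ℚ.< ε → fromℚ 0ℚ -ᴿ fromℚ ε <ᴿ term q
    -ε<term q {ε} 0<ε = ε , 0<ε , 0 , λ i _ → -ε+ε≤ ε (0≤weighted q (approx θ i))

-- Small values and multiples of convergents

0<1/n : ∀ n .{{_ : ℕ.NonZero n}} → 0ℚ ℚ.< (+ 1) / n
0<1/n n = ℚₚ.positive⁻¹ ((+ 1) / n) {{ℚₚ.normalize-pos 1 n}}

HasMultiple : ℕ → ℤ → ℤ → ℤ × ℤ → Set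
HasMultiple n m r L = ∃ λ g → InvertibleMod n g × ((g ⊙ L) ≈₂ (m , - r) [mod n ])

module _ (r : ℕ) (m : ℤ) (n : ℕ) .{{n≢0 : ℕ.NonZero n}} (r<n : r ℕ.< n) where
  open Approximation (+ r) m n

  -- Since r < n ≤ ∣nq∣, subtracting r cannot cancel nq; Legendre's argument needs Q ≠ 0.
  shifted-denominator>0 : ∀ {q} → 1 ℕ.≤ ∣ q ∣ → 1 ℕ.≤ ∣ + n ℤ.* q ℤ.- + r ∣
  shifted-denominator>0 {q} 1≤q = ℕₚ.+-cancelʳ-≤ r 1 ∣ Q ∣ (begin
    1 ℕ.+ r                       ≤⟨ r<n ⟩
    n                             ≤⟨ ℕₚ.m≤m*n n ∣ q ∣ {{ℕ.>-nonZero 1≤q}} ⟩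
    n ℕ.* ∣ q ∣                   ≡⟨ ℤₚ.abs-* (+ n) q ⟨
    ∣ + n ℤ.* q ∣                 ≡⟨ cong ∣_∣ (alg (+ n ℤ.* q) (+ r)) ⟩
    ∣ Q ℤ.+ + r ∣                 ≤⟨ ℤₚ.∣i+j∣≤∣i∣+∣j∣ Q (+ r) ⟩
    ∣ Q ∣ ℕ.+ r                   ∎)
    where
    open ℕₚ.≤-Reasoning
    Q : ℤ
    Q = + n ℤ.* q ℤ.- + r
    alg : ∀ x r → x ≡ x ℤ.- r ℤ.+ r
    alg = solve-∀

  shifted-denominator≤ : ∀ {q} → 1 ℕ.≤ ∣ q ∣ → ∣ + n ℤ.* q ℤ.- + r ∣ ℕ.≤ 2 ℕ.* n ℕ.* ∣ q ∣
  shifted-denominator≤ {q} 1≤q = begin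
    ∣ + n ℤ.* q ℤ.- + r ∣              ≤⟨ ℤₚ.∣i-j∣≤∣i∣+∣j∣ (+ n ℤ.* q) (+ r) ⟩
    ∣ + n ℤ.* q ∣ ℕ.+ r                ≡⟨ cong (ℕ._+ r) (ℤₚ.abs-* (+ n) q) ⟩
    n ℕ.* ∣ q ∣ ℕ.+ r                  ≤⟨ ℕₚ.+-monoʳ-≤ (n ℕ.* ∣ q ∣)
      (ℕₚ.≤-trans (ℕₚ.<⇒≤ r<n) (ℕₚ.m≤m*n n ∣ q ∣ {{ℕ.>-nonZero 1≤q}})) ⟩
    n ℕ.* ∣ q ∣ ℕ.+ n ℕ.* ∣ q ∣        ≡⟨ alg n ∣ q ∣ ⟩
    2 ℕ.* n ℕ.* ∣ q ∣                  ∎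
    where
    open ℕₚ.≤-Reasoning
    alg : ∀ n q → n ℕ.* q ℕ.+ n ℕ.* q ≡ 2 ℕ.* n ℕ.* q
    alg = ℕ-Solver.solve-∀

  -- In the constant, the outer n cancels the n multiplying qₖ, 2n comes from ∣Q∣ ≤ 2n ∣q∣, and 3 +
  -- M is the factor required for a quotient above M.
  small-numerator⇒multiple : ∀ b {k q z M} → gcd (gcd (+ r) m) (+ n) ≡ + 1 → 1 ℕ.≤ ∣ q ∣ →
    ∣ + n ℤ.* q ℤ.- + r ∣ ℕ.< k →
    n ℕ.* ((3 ℕ.+ M) ℕ.* (2 ℕ.* n)) ℕ.* (∣ q ∣ ℕ.* ∣ numerator q b k z ∣) ℕ.≤ n ℕ.* den b k →
    ∃ λ i → M ℕ.< ∣quotient∣ b (suc i) × HasMultiple n m (+ r) (convergent b i)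
  small-numerator⇒multiple b {k} {q} {z} {M} gcd≡1 1≤q Q<k small =
    let i , x , M< , P≡ , Q≡ = multiple-of-convergent b P Q {M} (shifted-denominator>0 1≤q) Q<k small′
        P≈ = multiple⇒≈ {n} {x ℤ.* num b i} {z} {m} (sym P≡)
        Q≈ = multiple⇒≈ {n} {x ℤ.* + den b i} {q} { - + r} (sym Q≡)
    in i , M< , subst (HasMultiple n m (+ r)) (sym (convergent-num-den b i))
         (x , multiplier-invertible {+ r} {m} {n} {x} {num b i} {+ den b i} gcd≡1 P≈ Q≈ , P≈ , Q≈)
    where
    Q P : ℤ
    Q = + n ℤ.* q ℤ.- + r
    P = + n ℤ.* z ℤ.+ m
    open ℕₚ.≤-Reasoning
    E : ℕ
    E = ∣ numerator q b k z ∣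
    alg : ∀ M n q E → n ℕ.* (M ℕ.* (2 ℕ.* n ℕ.* q ℕ.* E)) ≡ n ℕ.* (M ℕ.* (2 ℕ.* n)) ℕ.* (q ℕ.* E)
    alg = ℕ-Solver.solve-∀
    small′ : (3 ℕ.+ M) ℕ.* (∣ Q ∣ ℕ.* E) ℕ.≤ den b k
    small′ = begin
      (3 ℕ.+ M) ℕ.* (∣ Q ∣ ℕ.* E)                  ≤⟨ ℕₚ.*-monoʳ-≤ (3 ℕ.+ M) (ℕₚ.*-monoˡ-≤ E (shifted-denominator≤ 1≤q)) ⟩
      (3 ℕ.+ M) ℕ.* (2 ℕ.* n ℕ.* ∣ q ∣ ℕ.* E)      ≤⟨ ℕₚ.*-cancelˡ-≤ n
        (ℕₚ.≤-trans (ℕₚ.≤-reflexive (alg (3 ℕ.+ M) n ∣ q ∣ E)) small) ⟩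
      den b k                                      ∎

  module _ {b i g z q} (1≤g : 1 ℕ.≤ g) (g≤n : g ℕ.≤ n)
    (P≡ : + g ℤ.* num b i ≡ + n ℤ.* z ℤ.+ m) (Q≡ : + g ℤ.* + den b i ≡ + n ℤ.* q ℤ.- + r) where

    n*∣q∣ : n ℕ.* ∣ q ∣ ≡ g ℕ.* den b i ℕ.+ r
    n*∣q∣ = begin
      n ℕ.* ∣ q ∣                         ≡⟨ ℤₚ.abs-* (+ n) q ⟨
      ∣ + n ℤ.* q ∣                       ≡⟨ cong ∣_∣ (alg (+ n ℤ.* q) (+ r)) ⟩
      ∣ + n ℤ.* q ℤ.- + r ℤ.+ + r ∣       ≡⟨ cong (λ w → ∣ w ℤ.+ + r ∣) Q≡ ⟨
      ∣ + g ℤ.* + den b i ℤ.+ + r ∣       ≡⟨ cong (λ w → ∣ w ℤ.+ + r ∣) (ℤₚ.pos-* g (den b i)) ⟨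
      g ℕ.* den b i ℕ.+ r                 ∎
      where
      open ≡-Reasoning
      alg : ∀ x r → x ≡ x ℤ.- r ℤ.+ r
      alg = solve-∀

    den≤n*∣q∣ : den b i ℕ.≤ n ℕ.* ∣ q ∣
    den≤n*∣q∣ = ℕₚ.≤-trans (m≤n*m (den b i) 1≤g)
      (ℕₚ.≤-trans (ℕₚ.m≤m+n (g ℕ.* den b i) r) (ℕₚ.≤-reflexive (sym n*∣q∣)))

    ∣q∣≤2*den : ∣ q ∣ ℕ.≤ 2 ℕ.* den b i
    ∣q∣≤2*den = ℕₚ.*-cancelˡ-≤ n (begin
      n ℕ.* ∣ q ∣                        ≡⟨ n*∣q∣ ⟩
      g ℕ.* den b i ℕ.+ r                ≤⟨ ℕₚ.+-mono-≤ (ℕₚ.*-monoˡ-≤ (den b i) g≤n)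
        (ℕₚ.≤-trans (ℕₚ.<⇒≤ r<n) (ℕₚ.m≤m*n n (den b i) {{den-nonZero b i}})) ⟩
      n ℕ.* den b i ℕ.+ n ℕ.* den b i    ≡⟨ alg n (den b i) ⟩
      n ℕ.* (2 ℕ.* den b i)              ∎)
      where
      open ℕₚ.≤-Reasoning
      alg : ∀ n d → n ℕ.* d ℕ.+ n ℕ.* d ≡ n ℕ.* (2 ℕ.* d)
      alg = ℕ-Solver.solve-∀

    ∣numerator∣ : ∀ {k} → i ℕ.≤ k → ∣ numerator q b k z ∣ ≡ g ℕ.* gap b i k
    ∣numerator∣ {k} i≤k = begin
      ∣ numerator q b k z ∣
        ≡⟨ cong₂ (λ u v → ∣ u ℤ.* num b k ℤ.- v ℤ.* + den b k ∣) Q≡ P≡ ⟨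
      ∣ + g ℤ.* + den b i ℤ.* num b k ℤ.- + g ℤ.* num b i ℤ.* + den b k ∣
        ≡⟨ cong ∣_∣ (alg (+ g) (+ den b i) (num b k) (num b i) (+ den b k)) ⟩
      ∣ + g ℤ.* (+ den b i ℤ.* num b k ℤ.- num b i ℤ.* + den b k) ∣
        ≡⟨ ℤₚ.abs-* (+ g) (+ den b i ℤ.* num b k ℤ.- num b i ℤ.* + den b k) ⟩
      g ℕ.* ∣ + den b i ℤ.* num b k ℤ.- num b i ℤ.* + den b k ∣
        ≡⟨ cong (g ℕ.*_) (∣signed-gap∣ b i≤k) ⟩
      g ℕ.* gap b i k ∎
      where
      open ≡-Reasoning
      alg : ∀ g d n p e → g ℤ.* d ℤ.* n ℤ.- g ℤ.* p ℤ.* e ≡ g ℤ.* (d ℤ.* n ℤ.- p ℤ.* e)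
      alg = solve-∀

    -- From ∣q∣ ≤ 2qᵢ and ∣Qpₖ - Pqₖ∣ ≤ n times the gap, the left side is at most 2dn qᵢ times the
    -- gap; the 2 is why the quotient must reach 2d.
    multiple⇒small-numerator : ∀ d → 2 ℕ.* d ℕ.≤ ∣quotient∣ b (suc i) → ∀ {k} → i ℕ.< k →
      d ℕ.* (∣ q ∣ ℕ.* ∣ numerator q b k z ∣) ℕ.≤ n ℕ.* den b k
    multiple⇒small-numerator d 2d≤ {k} i<k = begin
      d ℕ.* (∣ q ∣ ℕ.* ∣ numerator q b k z ∣)
        ≡⟨ cong (λ e → d ℕ.* (∣ q ∣ ℕ.* e)) (∣numerator∣ (ℕₚ.<⇒≤ i<k)) ⟩
      d ℕ.* (∣ q ∣ ℕ.* (g ℕ.* gap b i k))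
        ≤⟨ ℕₚ.*-monoʳ-≤ d (ℕₚ.*-mono-≤ ∣q∣≤2*den (ℕₚ.*-monoˡ-≤ (gap b i k) g≤n)) ⟩
      d ℕ.* (2 ℕ.* den b i ℕ.* (n ℕ.* gap b i k))
        ≡⟨ alg d (den b i) n (gap b i k) ⟩
      n ℕ.* (2 ℕ.* d ℕ.* (den b i ℕ.* gap b i k))
        ≤⟨ ℕₚ.*-monoʳ-≤ n (ℕₚ.*-monoˡ-≤ (den b i ℕ.* gap b i k) 2d≤) ⟩
      n ℕ.* (∣quotient∣ b (suc i) ℕ.* (den b i ℕ.* gap b i k))
        ≤⟨ ℕₚ.*-monoʳ-≤ n (quotient*den*gap≤den b i<k) ⟩
      n ℕ.* den b k ∎
      where
      open ℕₚ.≤-Reasoning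
      alg : ∀ d e n g → d ℕ.* (2 ℕ.* e ℕ.* (n ℕ.* g)) ≡ n ℕ.* (2 ℕ.* d ℕ.* (e ℕ.* g))
      alg = ℕ-Solver.solve-∀

  reduced-multiple : ∀ b i → 2 ℕ.≤ n → HasMultiple n m (+ r) (convergent b i) →
    ∃ λ g → ∃₂ λ z q → 1 ℕ.≤ g × g ℕ.≤ n ×
      + g ℤ.* num b i ≡ + n ℤ.* z ℤ.+ m × + g ℤ.* + den b i ≡ + n ℤ.* q ℤ.- + r
  reduced-multiple b i 2≤n multiple =
    let g , invertible , P≈ , Q≈ = subst (HasMultiple n m (+ r)) (convergent-num-den b i) multiple
        z , P≡ = %-≈ g {num b i} {m} P≈
        q , Q≡ = %-≈ g {+ den b i} { - + r} Q≈
    in g ℤ-DivMod.%ℕ n , z , q , invertible⇒%≢0 {n} {g} 2≤n invertible ,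
       ℕₚ.<⇒≤ (ℤ-DivMod.n%ℕd<d g n) , P≡ , Q≡

  -- nN ≤ i ≤ qᵢ ≤ n ∣q∣, so a sufficiently late leaper makes ∣q∣ as large as required.
  late-multiple⇒small-numerators : ∀ b i d N → 2 ℕ.≤ n → n ℕ.* N ℕ.≤ i → 2 ℕ.* d ℕ.≤ ∣quotient∣ b (suc i) →
    HasMultiple n m (+ r) (convergent b i) →
    ∃₂ λ q z → N ℕ.≤ ∣ q ∣ × (∀ {k} → i ℕ.< k → d ℕ.* (∣ q ∣ ℕ.* ∣ numerator q b k z ∣) ℕ.≤ n ℕ.* den b k)
  late-multiple⇒small-numerators b i d N 2≤n nN≤i 2d≤ multiple =
    let g , z , q , 1≤g , g≤n , P≡ , Q≡ = reduced-multiple b i 2≤n multiple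
    in q , z ,
       ℕₚ.*-cancelˡ-≤ n (ℕₚ.≤-trans nN≤i (ℕₚ.≤-trans (den-growth b i) (den≤n*∣q∣ {b} {i} {g} {z} {q} 1≤g g≤n P≡ Q≡))) ,
       multiple⇒small-numerator {b} {i} {g} {z} {q} 1≤g g≤n P≡ Q≡ d 2d≤

  -- The two implications of the equivalence

  module _ {θ b} (cf : θ HasCF b) where

    φ : ℝ
    φ = ((+ 1) / n) · (fromℤ (+ r) · θ +ᴿ fromℚ (fromℤ m))

    L≡0⇒small-numerator : IsInhomogeneousConstant θ φ (fromℚ 0ℚ) → ∀ T .{{_ : ℕ.NonZero T}} →
      ∃ λ q → ∃₂ λ k z → 1 ℕ.≤ ∣ q ∣ × ∣ + n ℤ.* q ℤ.- + r ∣ ℕ.< k ×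
        T ℕ.* (∣ q ∣ ℕ.* ∣ numerator q b k z ∣) ℕ.≤ n ℕ.* den b k
    -- The bound 1 on ∣q∣ excludes q = 0, where nothing would keep ∣Q∣ positive.
    L≡0⇒small-numerator (_ , small) T = from-term (small ((+ 1) / T) (0<1/n T) 1)
      where
      from-term : (∃ λ q → 1 ℕ.≤ ∣ q ∣ × term {θ} {b} cf (+ r) m n q <ᴿ fromℚ 0ℚ +ᴿ fromℚ ((+ 1) / T)) →
        ∃ λ q → ∃₂ λ k z → 1 ℕ.≤ ∣ q ∣ × ∣ + n ℤ.* q ℤ.- + r ∣ ℕ.< k ×
          T ℕ.* (∣ q ∣ ℕ.* ∣ numerator q b k z ∣) ℕ.≤ n ℕ.* den b k
      from-term (q , 1≤q , term<) =
        let k , Q<k , weighted≤ = term<⇒weighted≤ {θ} {b} cf (+ r) m n q term< (suc ∣ + n ℤ.* q ℤ.- + r ∣)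
            z , small-numerator = small-weighted⇒small-numerator q b k T weighted≤
        in q , k , z , 1≤q , Q<k , small-numerator

    small-numerators⇒L≡0 :
      (∀ d N → ∃ λ i → ∃₂ λ q z → N ℕ.≤ ∣ q ∣ ×
        (∀ {k} → i ℕ.< k → d ℕ.* (∣ q ∣ ℕ.* ∣ numerator q b k z ∣) ℕ.≤ n ℕ.* den b k)) →
      IsInhomogeneousConstant θ φ (fromℚ 0ℚ)
    small-numerators⇒L≡0 small =
      -- The lower half of the liminf holds from threshold 0 on, because the terms are nonnegative.
      (λ ε 0<ε → 0 , λ q _ → -ε<term {θ} {b} cf (+ r) m n q 0<ε) ,
      (λ ε 0<ε N → to-term 0<ε (small (↧ₙ (½ ℚ.* ε)) N))
      where
      to-term : ∀ {ε N} → 0ℚ ℚ.< ε → (∃ λ i → ∃₂ λ q z → N ℕ.≤ ∣ q ∣ ×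
        (∀ {k} → i ℕ.< k → ↧ₙ (½ ℚ.* ε) ℕ.* (∣ q ∣ ℕ.* ∣ numerator q b k z ∣) ℕ.≤ n ℕ.* den b k)) →
        ∃ λ q → N ℕ.≤ ∣ q ∣ × term {θ} {b} cf (+ r) m n q <ᴿ fromℚ 0ℚ +ᴿ fromℚ ε
      to-term 0<ε (i , q , z , N≤q , bound) = q , N≤q ,
        weighted≤⇒term< {θ} {b} cf (+ r) m n q 0<ε (suc i) λ k i<k →
          small-numerator⇒small-weighted q b k z (0<½* 0<ε) (bound i<k)

  module _ {θ b c a ns} (cf : θ HasCF b) (form : HasForm b c a ns) where

    L≡0⇒leapers : Bounded c → gcd (gcd (+ r) m) (+ n) ≡ + 1 →
      IsInhomogeneousConstant θ (φ {θ} {b} cf) (fromℚ 0ℚ) →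
      InfinitelyMany (λ j → HasMultiple n m (+ r) (leaper b ns j))
    L≡0⇒leapers bounded gcd≡1 L≡0 J =
      let q , k , z , 1≤q , Q<k , small = L≡0⇒small-numerator {θ} {b} cf L≡0 (n ℕ.* ((3 ℕ.+ M) ℕ.* (2 ℕ.* n)))
      in late-leaper q k z 1≤q Q<k small
      where
      M : ℕ
      M = proj₁ bounded ℕ.+ partialSum (λ j → ∣ a j ∣) J
      instance
        T-nonZero : ℕ.NonZero (n ℕ.* ((3 ℕ.+ M) ℕ.* (2 ℕ.* n)))
        T-nonZero = ℕₚ.m*n≢0 n ((3 ℕ.+ M) ℕ.* (2 ℕ.* n)) {{n≢0}}
          {{ℕₚ.m*n≢0 (3 ℕ.+ M) (2 ℕ.* n) {{_}} {{ℕₚ.m*n≢0 2 n {{_}} {{n≢0}}}}}}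
      late-leaper : ∀ q k z → 1 ℕ.≤ ∣ q ∣ → ∣ + n ℤ.* q ℤ.- + r ∣ ℕ.< k →
        n ℕ.* ((3 ℕ.+ M) ℕ.* (2 ℕ.* n)) ℕ.* (∣ q ∣ ℕ.* ∣ numerator q b k z ∣) ℕ.≤ n ℕ.* den b k →
        ∃ λ j → J ℕ.≤ j × HasMultiple n m (+ r) (leaper b ns j)
      late-leaper q k z 1≤q Q<k small =
        let i , M< , multiple = small-numerator⇒multiple b {k} {q} {z} {M} gcd≡1 1≤q Q<k small
            j , J≤j , i≡ = large-quotient⇒late-leap form bounded J M<
        in j , J≤j , subst (λ i → HasMultiple n m (+ r) (convergent b i)) i≡ multiple

    leapers⇒L≡0 : TendsToInfinity a → 2 ℕ.≤ n →
      InfinitelyMany (λ j → HasMultiple n m (+ r) (leaper b ns j)) →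
      IsInhomogeneousConstant θ (φ {θ} {b} cf) (fromℚ 0ℚ)
    leapers⇒L≡0 a→∞ 2≤n leapers = small-numerators⇒L≡0 {θ} {b} cf λ d N →
      let J₀ , large = a→∞ (+ (2 ℕ.* d))
          -- Beyond J₀ the term aⱼ is at least 2d; beyond nN also Iⱼ ≥ j ≥ nN, which forces ∣q∣ ≥ N.
          j , J≤j , multiple = leapers (J₀ ℕ.⊔ n ℕ.* N)
          i = leapingSubscript ns j
          2d≤ = ℤₚ.drop‿+≤+ (subst (+ (2 ℕ.* d) ℤ.≤_)
            (trans (sym (HasForm.leap-term form j)) (sym (+∣quotient∣ b i)))
            (large j (ℕₚ.m⊔n≤o⇒m≤o J₀ (n ℕ.* N) J≤j)))
          nN≤ = ℕₚ.≤-trans (ℕₚ.m⊔n≤o⇒n≤o J₀ (n ℕ.* N) J≤j) (ℕₚ.m≤n+m j (partialSum ns (suc j)))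
      in i , late-multiple⇒small-numerators b i d N 2≤n nN≤ 2d≤ multiple

theorem2p3 : (θ : ℝ) (b : SimpleCF) (c a : ℕ → ℤ) (ns : ℕ → ℕ) →
    θ HasCF b → HasForm b c a ns → TendsToInfinity a → Bounded c →
    (r m : ℤ) (n : ℕ) .{{_ : NonZero n}} → 2 ≤ℕ n →
    gcd (gcd r m) (+ n) ≡ + 1 →
    + 0 ≤ r → r < + n → + 0 ≤ m → m < + n →
    IsInhomogeneousConstant θ (((+ 1) / n) · (fromℤ r · θ +ᴿ fromℚ (fromℤ m))) (fromℚ 0ℚ) ⇔
    InfinitelyMany (λ j → ∃ λ g → InvertibleMod n g × ((g ⊙ leaper b ns j) ≈₂ (m , - r) [mod n ]))
theorem2p3 θ b c a ns cf form a→∞ bounded (+ r) m n 2≤n gcd≡1 _ (ℤ.+<+ r<n) _ _ = mk⇔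
  (L≡0⇒leapers r m n r<n {θ} {b} cf form bounded gcd≡1)
  (leapers⇒L≡0 r m n r<n {θ} {b} cf form a→∞ 2≤n)
theorem2p3 θ b c a ns cf form a→∞ bounded -[1+ r ] m n 2≤n gcd≡1 () _ _ _
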